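{- Let $\mathbf{u}$ be a uniformly recurrent infinite word over a finite alphabet $\mathcal{A}$ with $\#\mathcal{A}=k$, and assume that every palindrome in $\mathcal{L}(\mathbf{u})$ has a unique palindromic extension in $\mathbf{u}$. Then $\mathbf{u}$ is rich if and only if every factor of $\mathbf{u}$ has exactly $k$ return words.
   Context: An infinite word over a finite alphabet $\mathcal{A}$ is a one-sided infinite sequence $\mathbf{u}=u_0u_1u_2\ldots$ of letters of $\mathcal{A}$ in which every letter of $\mathcal{A}$ occurs. Its language $\mathcal{L}(\mathbf{u})$ is the set of all its finite factors (contiguous subwords), including the empty word. An occurrence of a factor $w$ is an index $i$ such that $w$ is a prefix of $u_iu_{i+1}u_{i+2}\ldots$. $\mathbf{u}$ is recurrent if every factor has at least two (equivalently infinitely many) occurrences, and uniformly recurrent if, moreover, for every factor $w$ the distances between successive occurrences of $w$ are bounded. If $i<j$ are two successive occurrences of $w$ in $\mathbf{u}$, the word $u_iu_{i+1}\cdots u_{j-1}$ is a return word of $w$; the return words of $w$ are counted as distinct words. A word is a palindrome if it equals its reversal (the empty word is a palindrome). For a palindrome $w\in\mathcal{L}(\mathbf{u})$, a palindromic extension of $w$ is a word $awa\in\mathcal{L}(\mathbf{u})$ with $a\in\mathcal{A}$. $\mathbf{u}$ is rich if every factor $w$ of $\mathbf{u}$ contains exactly $|w|+1$ distinct palindromic factors (including the empty word). -}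

module Defs where

open import Data.List.Base using (List; _∷_; _∷ʳ_; length; reverse; applyUpTo)
open import Data.List.Membership.Propositional using (_∈_)
open import Data.List.Relation.Binary.Infix.Heterogeneous using (Infix)
open import Data.List.Relation.Unary.Unique.Propositional using (Unique)
open import Data.Nat.Base using (ℕ; suc; _+_; _∸_; _<_; _≤_)
open import Data.Product.Base using (∃; ∃-syntax; ∃₂; _×_)
open import Data.Product using (∃!)
open import Function.Bundles using (_⇔_)
open import Level using (Level; _⊔_)
open import Relation.Binary.PropositionalEquality.Core using (_≡_)
open import Relation.Nullary.Negation.Core using (¬_)

private
  variable
    a p : Level
    A : Set a

-- Exactly n elements, counted up to propositional equality, satisfy P.
HasExactly : {A : Set a} → ℕ → (A → Set p) → Set (a ⊔ p)
HasExactly {A = A} n P =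
  ∃[ xs ] Unique {A = A} xs × length xs ≡ n × (∀ x → x ∈ xs ⇔ P x)

InfiniteWord : Set a → Set a
InfiniteWord A = ℕ → A

EveryLetterOccurs : {A : Set a} → InfiniteWord A → Set a
EveryLetterOccurs u = ∀ c → ∃[ i ] u i ≡ c

-- segment u i n = u_i u_{i+1} ⋯ u_{i+n-1}
segment : InfiniteWord A → ℕ → ℕ → List A
segment u i n = applyUpTo (λ m → u (i + m)) n

OccursAt : {A : Set a} → InfiniteWord A → List A → ℕ → Set a
OccursAt u w i = segment u i (length w) ≡ w

Language : {A : Set a} → InfiniteWord A → List A → Set a
Language u w = ∃[ i ] OccursAt u w i

SuccessiveOccurrences : {A : Set a} → InfiniteWord A → List A → ℕ → ℕ → Set a
SuccessiveOccurrences u w i j =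
  i < j × OccursAt u w i × OccursAt u w j ×
  (∀ m → i < m → m < j → ¬ OccursAt u w m)

Recurrent : {A : Set a} → InfiniteWord A → Set a
Recurrent u =
  ∀ w → Language u w → ∃₂ λ i j → i < j × OccursAt u w i × OccursAt u w j

UniformlyRecurrent : {A : Set a} → InfiniteWord A → Set a
UniformlyRecurrent u =
  Recurrent u ×
  (∀ w → Language u w →
     ∃[ N ] (∀ i j → SuccessiveOccurrences u w i j → j ∸ i ≤ N))

ReturnWord : {A : Set a} → InfiniteWord A → List A → List A → Set a
ReturnWord u w v =
  ∃₂ λ i j → SuccessiveOccurrences u w i j × v ≡ segment u i (j ∸ i)

Palindrome : {A : Set a} → List A → Set a
Palindrome w = reverse w ≡ w

PalindromicExtension : {A : Set a} → InfiniteWord A → List A → List A → Set a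
PalindromicExtension u w v = Language u v × ∃[ c ] v ≡ c ∷ (w ∷ʳ c)

UniquePalindromicExtensions : {A : Set a} → InfiniteWord A → Set a
UniquePalindromicExtensions u =
  ∀ w → Language u w → Palindrome w → ∃! _≡_ (PalindromicExtension u w)

Rich : {A : Set a} → InfiniteWord A → Set a
Rich u =
  ∀ w → Language u w →
  HasExactly (suc (length w)) (λ v → Palindrome v × Infix _≡_ v w)

{-# OPTIONS --safe #-}
-- Unique palindromic extensions make every palindrome of the language determined by its
-- centre (one of the k letters, or nothing) and its radius. For a factor w, each of the
-- k + 1 centres not carrying w itself has a hull, the least palindrome around it that
-- contains w; the hulls are exactly the palindromic words spanning two successive
-- occurrences of {w, reverse w}. A palindromic w therefore has exactly k palindromic complete
-- returns, so it has k return words iff all its complete returns are palindromes, and the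
-- latter for all palindromes w is richness.
-- For w not a palindrome in a rich word, occurrences of w and reverse w alternate, and u
-- walks on the graph whose vertices are the k + 1 hulls. Complete returns to hulls being
-- palindromes, a step to an already visited hull retraces an old edge, so the graph is a
-- tree; its k edges are the return words of w.
module Submission where

open import Data.Empty using (⊥-elim)
open import Data.Fin.Base using (Fin)
import Data.Fin.Properties as Fin
open import Data.List.Base using (List; []; _∷_; _++_; _∷ʳ_; [_]; length; reverse; allFin;
  initLast; _∷ʳ′_; applyUpTo)
open import Data.List.Membership.Propositional using (_∈_)
open import Data.List.Membership.Propositional.Properties using (∈-∃++; ∈-allFin; ∈-++⁻; ∈-++⁺ˡ; ∈-++⁺ʳ)
open import Data.List.Properties
open import Data.List.Relation.Binary.Infix.Heterogeneous using (Infix; MkView; toView; fromView)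
open import Data.List.Relation.Binary.Infix.Heterogeneous.Properties using (infix?)
import Data.List.Relation.Binary.Pointwise as Pointwise
open import Data.List.Relation.Unary.All using ([]; _∷_)
import Data.List.Relation.Unary.All as All
open import Data.List.Relation.Unary.AllPairs using ([]; _∷_)
open import Data.List.Relation.Unary.Any using (here; there)
open import Data.List.Relation.Unary.Unique.Propositional using (Unique)
open import Data.List.Relation.Unary.Unique.Propositional.Properties using (allFin⁺)
open import Data.List.Reverse using (Reverse; reverseView; []; _∶_∶ʳ_)
open import Data.Maybe.Base using (Maybe; just; nothing)
import Data.Maybe.Properties as Maybe
open import Data.Nat.Base using (ℕ; zero; suc; _+_; _∸_; _≤_; _<_; z≤n; s≤s)
open import Data.Nat.Properties hiding (_≟_)
import Data.Nat.Properties as ℕ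
open import Data.Product.Base using (∃-syntax; ∃₂; Σ-syntax; _×_; _,_; proj₁; proj₂; map₂)
open import Data.Sum.Base using (_⊎_; inj₁; inj₂; swap)
open import Data.Unit.Base using (⊤; tt)
open import Function.Base using (_∘_)
open import Function.Bundles using (_⇔_; _↔_; mk⇔; Inverse; Equivalence)
open import Function.Construct.Symmetry using (⇔-sym)
open import Function.Properties.Inverse using (↔⇒↣)
open import Level using (Level)
open import Relation.Binary.Definitions using (DecidableEquality; tri<; tri≈; tri>)
open import Relation.Binary.PropositionalEquality hiding ([_])
open import Relation.Nullary using (¬_; Dec; yes; no)
open import Relation.Nullary.Decidable using (map′; _⊎-dec_; via-injection)
open import Relation.Unary using (Decidable)

open import Defs

-- No list of return words is at hand to be counted. Every count is transported along a relation
-- from `Maybe A` minus one centre: for a palindrome its own centre, otherwise the root of the tree.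
-- Richness enters through the classical criterion that each nonempty factor ends in a palindrome
-- occurring in it only once. A return word v of a non-palindrome w is an edge because of the
-- alternation: v w has exactly one copy of reverse w between its two ends, so it glues two hulls
-- along reverse w. Crossing the same edge backwards glues them along w. Looking only at reverse w
-- thus selects one direction, and each edge yields one return word. Each hull other than the first
-- on the walk has as parent the hull traversed just before its own first occurrence, and an edge is
-- counted at its child. Absence of cycles then means that every edge joins a hull to its parent.

private
  variable
    a b p q r : Level
    A B : Set a

-- Counting with duplicate-free lists and relational bijections

∈-length-≤ : {xs ys : List A} → Unique xs → (∀ {x} → x ∈ xs → x ∈ ys) → length xs ≤ length ys
∈-length-≤ {xs = []} _ _ = z≤n
∈-length-≤ {xs = x ∷ xs} (x∉ ∷ uniq) sub with ∈-∃++ (sub (here refl))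
... | ys₁ , ys₂ , refl =
  ≤-trans (s≤s (∈-length-≤ uniq sub′)) (≤-reflexive (sym (length-++-sucʳ ys₁ x ys₂)))
  where
  sub′ : ∀ {y} → y ∈ xs → y ∈ ys₁ ++ ys₂
  sub′ y∈ with ∈-++⁻ ys₁ (sub (there y∈))
  ... | inj₁ y∈₁ = ∈-++⁺ˡ y∈₁
  ... | inj₂ (here refl) = ⊥-elim (All.lookup x∉ y∈ refl)
  ... | inj₂ (there y∈₂) = ∈-++⁺ʳ ys₁ y∈₂

module _ {P : A → Set p} {Q : A → Set q} where

  HasExactly-mono : ∀ {m n} → HasExactly m P → HasExactly n Q → (∀ {x} → P x → Q x) → m ≤ n
  HasExactly-mono (_ , uniq , refl , P⇔) (_ , _ , refl , Q⇔) P⊆Q =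
    ∈-length-≤ uniq (λ {x} → Equivalence.from (Q⇔ x) ∘ P⊆Q ∘ Equivalence.to (P⇔ x))

  -- Pigeonhole: a `Q`-element outside `P` could be put in front of the list for `P`, giving n + 1
  -- distinct entries inside a list of n.
  HasExactly-saturated : DecidableEquality A → ∀ {n} → HasExactly n P → HasExactly n Q →
    (∀ {x} → P x → Q x) → ∀ {x} → Q x → P x
  HasExactly-saturated _≟_ (xs , uniq , refl , P⇔) (ys , _ , eq , Q⇔) P⊆Q {x} Qx with x ∈? xs
    where open import Data.List.Membership.DecPropositional _≟_ using (_∈?_)
  ... | yes x∈ = Equivalence.to (P⇔ x) x∈
  ... | no x∉ = ⊥-elim (<-irrefl (sym eq) (∈-length-≤ (All.tabulate (λ y∈ → λ where refl → x∉ y∈) ∷ uniq) sub))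
    where
    sub : ∀ {y} → y ∈ x ∷ xs → y ∈ ys
    sub (here refl) = Equivalence.from (Q⇔ x) Qx
    sub (there y∈) = Equivalence.from (Q⇔ _) (P⊆Q (Equivalence.to (P⇔ _) y∈))

HasExactly-cong : ∀ {n} {P : A → Set p} {Q : A → Set q} →
  (∀ x → P x ⇔ Q x) → HasExactly n P → HasExactly n Q
HasExactly-cong P⇔Q (xs , uniq , len , xs⇔) = xs , uniq , len , λ x →
  mk⇔ (Equivalence.to (P⇔Q x) ∘ Equivalence.to (xs⇔ x)) (Equivalence.from (xs⇔ x) ∘ Equivalence.from (P⇔Q x))

module _ {P : A → Set p} {Q : B → Set q} (R : A → B → Set r)
  (total : ∀ {x} → P x → ∃[ y ] R x y × Q y)
  (onto : ∀ {y} → Q y → ∃[ x ] P x × R x y)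
  (functional : ∀ {x y z} → R x y → R x z → y ≡ z)
  (injective : ∀ {x y z} → R x z → R y z → x ≡ y)
  where

  private
    images : (xs : List A) → Unique xs → (∀ {x} → x ∈ xs → P x) →
      ∃[ ys ] Unique ys × length ys ≡ length xs ×
      (∀ {x} → x ∈ xs → ∃[ y ] R x y × y ∈ ys) × (∀ {y} → y ∈ ys → ∃[ x ] x ∈ xs × R x y × Q y)
    images [] _ _ = [] , [] , refl , (λ ()) , (λ ())
    images (x ∷ xs) (x∉ ∷ uniq) sub with total (sub (here refl)) | images xs uniq (sub ∘ there)
    ... | y , Rxy , Qy | ys , uniq′ , len , fwd , bwd =
      y ∷ ys , All.tabulate fresh ∷ uniq′ , cong suc len ,
      (λ { (here refl) → y , Rxy , here refl
         ; (there x∈) → let z , Rxz , z∈ = fwd x∈ in z , Rxz , there z∈ }) ,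
      (λ { (here refl) → x , here refl , Rxy , Qy
         ; (there y∈) → let z , z∈ , Rzy = bwd y∈ in z , there z∈ , Rzy })
      where
      fresh : ∀ {z} → z ∈ ys → y ≢ z
      fresh z∈ refl with bwd z∈
      ... | x′ , x′∈ , Rx′y , _ = All.lookup x∉ x′∈ (injective Rxy Rx′y)

  -- `R` is a relation and not a function because the partner of an element may come with auxiliary
  -- data, such as a parent; only its value has to be unique.
  HasExactly-bijection : ∀ {n} → HasExactly n P → HasExactly n Q
  HasExactly-bijection (xs , uniq , refl , P⇔) with images xs uniq (λ {x} → Equivalence.to (P⇔ x))
  ... | ys , uniq′ , len , fwd , bwd = ys , uniq′ , len , λ y →
    mk⇔ (λ y∈ → let _ , _ , _ , Qy = bwd y∈ in Qy)
        (λ Qy → let x , Px , Rxy = onto Qy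
                    z , Rxz , z∈ = fwd (Equivalence.from (P⇔ x) Px)
                in subst (_∈ ys) (functional Rxz Rxy) z∈)

HasExactly-Fin : ∀ {k} → A ↔ Fin k → HasExactly k (λ (_ : A) → ⊤)
HasExactly-Fin {A = A} {k} A↔Fin =
  HasExactly-bijection (λ i x → Inverse.to A↔Fin x ≡ i)
    (λ {i} _ → Inverse.from A↔Fin i , Inverse.strictlyInverseˡ A↔Fin i , tt)
    (λ _ → _ , tt , refl)
    (λ { refl eq → trans (sym (Inverse.strictlyInverseʳ A↔Fin _))
                     (trans (cong (Inverse.from A↔Fin) (sym eq)) (Inverse.strictlyInverseʳ A↔Fin _)) })
    (λ { refl refl → refl })
    (allFin k , allFin⁺ k , length-tabulate (λ i → i) , λ i → mk⇔ (λ _ → tt) (λ _ → ∈-allFin i))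

-- Exchanging nothing with the removed value identifies Maybe A minus a point with A.
HasExactly-Maybe-≢ : DecidableEquality A → ∀ {k} → HasExactly k (λ (_ : A) → ⊤) →
  (y₀ : Maybe A) → HasExactly k (_≢ y₀)
HasExactly-Maybe-≢ {A = A} _≟_ hyp y₀ = HasExactly-bijection R total onto functional injective hyp
  where
  R : A → Maybe A → Set _
  R x y = y ≢ y₀ × (y ≡ just x ⊎ (y ≡ nothing × y₀ ≡ just x))

  total : ∀ {x} → ⊤ → ∃[ y ] R x y × y ≢ y₀
  total {x} _ with Maybe.≡-dec _≟_ (just x) y₀
  ... | yes refl = nothing , ((λ ()) , inj₂ (refl , refl)) , (λ ())
  ... | no ≢y₀ = just x , (≢y₀ , inj₁ refl) , ≢y₀

  onto : ∀ {y} → y ≢ y₀ → ∃[ x ] ⊤ × R x y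
  onto {just x} ≢y₀ = x , tt , ≢y₀ , inj₁ refl
  onto {nothing} ≢y₀ = removed y₀ refl
    where
    removed : ∀ m → y₀ ≡ m → ∃[ x ] ⊤ × R x nothing
    removed (just x) eq = x , tt , ≢y₀ , inj₂ (refl , eq)
    removed nothing eq = ⊥-elim (≢y₀ (sym eq))

  functional : ∀ {x y z} → R x y → R x z → y ≡ z
  functional (_ , inj₁ refl) (_ , inj₁ refl) = refl
  functional (≢y₀ , inj₁ refl) (_ , inj₂ (_ , eq)) = ⊥-elim (≢y₀ (sym eq))
  functional (_ , inj₂ (_ , eq)) (≢y₀ , inj₁ refl) = ⊥-elim (≢y₀ (sym eq))
  functional (_ , inj₂ (refl , _)) (_ , inj₂ (refl , _)) = refl

  injective : ∀ {x y z} → R x z → R y z → x ≡ y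
  injective (_ , inj₁ refl) (_ , inj₁ refl) = refl
  injective (_ , inj₂ (refl , refl)) (_ , inj₂ (_ , refl)) = refl

-- Splittings of words, factors and reversal

module _ {A : Set a} where

  split-≤ˡ : ∀ (xs : List A) {ys} xs′ {ys′} → xs ++ ys ≡ xs′ ++ ys′ → length xs ≤ length xs′ →
    ∃[ zs ] xs′ ≡ xs ++ zs × ys ≡ zs ++ ys′
  split-≤ˡ [] xs′ eq _ = xs′ , refl , eq
  split-≤ˡ (x ∷ xs) (x′ ∷ xs′) eq (s≤s le) with ∷-injective eq
  ... | refl , eq′ with split-≤ˡ xs xs′ eq′ le
  ... | zs , refl , eq″ = zs , refl , eq″

  split-compare : ∀ (xs : List A) {ys} xs′ {ys′} → xs ++ ys ≡ xs′ ++ ys′ →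
    (∃[ zs ] xs′ ≡ xs ++ zs × ys ≡ zs ++ ys′) ⊎ (∃[ zs ] xs ≡ xs′ ++ zs × ys′ ≡ zs ++ ys)
  split-compare xs xs′ eq with ≤-total (length xs) (length xs′)
  ... | inj₁ le = inj₁ (split-≤ˡ xs xs′ eq le)
  ... | inj₂ ge = inj₂ (split-≤ˡ xs′ xs (sym eq) ge)

  split-≡ˡ : ∀ (xs : List A) {ys} xs′ {ys′} → xs ++ ys ≡ xs′ ++ ys′ → length xs ≡ length xs′ →
    xs ≡ xs′ × ys ≡ ys′
  split-≡ˡ [] [] eq _ = refl , eq
  split-≡ˡ (x ∷ xs) (x′ ∷ xs′) eq len with ∷-injective eq
  ... | refl , eq′ with split-≡ˡ xs xs′ eq′ (suc-injective len)
  ... | refl , eq″ = refl , eq″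

  length-split : ∀ (xs : List A) {ys} xs′ {ys′} → xs ++ ys ≡ xs′ ++ ys′ →
    length xs + length ys ≡ length xs′ + length ys′
  length-split xs xs′ eq = trans (sym (length-++ xs)) (trans (cong length eq) (length-++ xs′))

  split-≤ʳ : ∀ (xs : List A) {ys} xs′ {ys′} → xs ++ ys ≡ xs′ ++ ys′ → length ys′ ≤ length ys →
    ∃[ zs ] xs′ ≡ xs ++ zs × ys ≡ zs ++ ys′
  split-≤ʳ xs {ys} xs′ {ys′} eq le with split-compare xs xs′ eq
  ... | inj₁ found = found
  ... | inj₂ ([] , refl , refl) = [] , sym (trans (++-identityʳ _) (++-identityʳ _)) , refl
  ... | inj₂ (z ∷ zs , refl , refl) = ⊥-elim (<-irrefl refl (≤-trans (s≤s (length-++-≤ʳ ys {zs})) le))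

  split-≡ʳ : ∀ (xs : List A) {ys} xs′ {ys′} → xs ++ ys ≡ xs′ ++ ys′ → length ys ≡ length ys′ →
    xs ≡ xs′ × ys ≡ ys′
  split-≡ʳ xs {ys} xs′ {ys′} eq len = split-≡ˡ xs xs′ eq
    (+-cancelʳ-≡ (length ys) _ _ (trans (length-split xs xs′ eq) (cong (length xs′ +_) (sym len))))

  ++-[]-length : ∀ (xs : List A) ys → length (xs ++ ys) ≤ length ys → xs ≡ []
  ++-[]-length [] ys _ = refl
  ++-[]-length (x ∷ xs) ys le = ⊥-elim (<-irrefl refl (≤-trans (s≤s (length-++-≤ʳ ys {xs})) le))

  ++-selfʳ : ∀ (xs : List A) {ys} → xs ≡ xs ++ ys → ys ≡ []
  ++-selfʳ xs eq = sym (++-cancelˡ xs _ _ (trans (++-identityʳ xs) eq))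

  Factor : List A → List A → Set a
  Factor w f = ∃₂ λ c d → f ≡ c ++ w ++ d

  Factor⇒Infix : ∀ {w f} → Factor w f → Infix _≡_ w f
  Factor⇒Infix (c , d , refl) = fromView (MkView c (Pointwise.refl refl) d)

  Infix⇒Factor : ∀ {w f} → Infix _≡_ w f → Factor w f
  Infix⇒Factor inf with toView inf
  ... | MkView c pw d with Pointwise.Pointwise-≡⇒≡ pw
  ... | refl = c , d , refl

  factorisation-trans : ∀ (c : List A) u {d} c′ {v d′ w} → v ≡ c ++ u ++ d → w ≡ c′ ++ v ++ d′ →
    w ≡ (c′ ++ c) ++ u ++ d ++ d′
  factorisation-trans c u {d} c′ {d′ = d′} refl refl = begin
    c′ ++ (c ++ u ++ d) ++ d′   ≡⟨ cong (c′ ++_) (++-assoc c (u ++ d) d′) ⟩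
    c′ ++ c ++ (u ++ d) ++ d′   ≡⟨ cong (λ t → c′ ++ c ++ t) (++-assoc u d d′) ⟩
    c′ ++ c ++ u ++ d ++ d′     ≡⟨ ++-assoc c′ c _ ⟨
    (c′ ++ c) ++ u ++ d ++ d′   ∎
    where open ≡-Reasoning

  Factor-trans : ∀ {u v w} → Factor u v → Factor v w → Factor u w
  Factor-trans {u} (c , d , eq) (c′ , d′ , eq′) = c′ ++ c , d ++ d′ , factorisation-trans c u c′ eq eq′

  Factor? : DecidableEquality A → ∀ w f → Dec (Factor w f)
  Factor? _≟_ w f = map′ Infix⇒Factor Factor⇒Infix (infix? _≟_ w f)

  Factor-length : ∀ {w f} → Factor w f → length w ≤ length f
  Factor-length {w} (c , d , refl) = ≤-trans (length-++-≤ˡ w) (length-++-≤ʳ (w ++ d) {c})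

  reverse-++₃ : ∀ (c w d : List A) → reverse (c ++ w ++ d) ≡ reverse d ++ reverse w ++ reverse c
  reverse-++₃ c w d = begin
    reverse (c ++ w ++ d)                   ≡⟨ reverse-++ c (w ++ d) ⟩
    reverse (w ++ d) ++ reverse c           ≡⟨ cong (_++ reverse c) (reverse-++ w d) ⟩
    (reverse d ++ reverse w) ++ reverse c   ≡⟨ ++-assoc (reverse d) (reverse w) _ ⟩
    reverse d ++ reverse w ++ reverse c     ∎
    where open ≡-Reasoning

  reverse-≢[] : ∀ {xs : List A} → xs ≢ [] → reverse xs ≢ []
  reverse-≢[] ≢[] eq = ≢[] (reverse-injective eq)

  ++-≢[]ˡ : ∀ {xs ys : List A} → xs ≢ [] → xs ++ ys ≢ []
  ++-≢[]ˡ {[]} ≢[] _ = ≢[] refl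

  ++-≢[]ʳ : ∀ xs {ys : List A} → ys ≢ [] → xs ++ ys ≢ []
  ++-≢[]ʳ [] ≢[] = ≢[]

  palindrome-++ : ∀ (xs : List A) {ys f} → Palindrome f → f ≡ xs ++ ys → f ≡ reverse ys ++ reverse xs
  palindrome-++ xs pal refl = trans (sym pal) (reverse-++ xs _)

  length-≢[] : ∀ {xs : List A} → xs ≢ [] → 0 < length xs
  length-≢[] {[]} ≢[] = ⊥-elim (≢[] refl)
  length-≢[] {_ ∷ _} _ = s≤s z≤n

  []? : (xs : List A) → Dec (xs ≡ [])
  []? [] = yes refl
  []? (_ ∷ _) = no (λ ())

-- Segments, occurrences and uniform recurrence

applyUpTo-cong : {f g : ℕ → A} → (∀ m → f m ≡ g m) → ∀ n → applyUpTo f n ≡ applyUpTo g n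
applyUpTo-cong eq zero = refl
applyUpTo-cong eq (suc n) = cong₂ _∷_ (eq 0) (applyUpTo-cong (eq ∘ suc) n)

applyUpTo-+ : (f : ℕ → A) → ∀ m n →
  applyUpTo f (m + n) ≡ applyUpTo f m ++ applyUpTo (λ i → f (m + i)) n
applyUpTo-+ f zero n = refl
applyUpTo-+ f (suc m) n = cong (f 0 ∷_) (applyUpTo-+ (f ∘ suc) m n)

nearest-below : {P : ℕ → Set p} → Decidable P → ∀ {i n} → i < n → P i →
  ∃[ j ] i ≤ j × j < n × P j × (∀ m → j < m → m < n → ¬ P m)
nearest-below P? {i} {suc n} (s≤s i≤n) Pi with P? n
... | yes Pn = n , i≤n , ≤-refl , Pn , λ m n<m m≤n _ → <-irrefl refl (≤-trans n<m (≤-pred m≤n))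
... | no ¬Pn with nearest-below P? (≤∧≢⇒< i≤n (λ { refl → ¬Pn Pi })) Pi
... | j , i≤j , j<n , Pj , none = j , i≤j , m≤n⇒m≤1+n j<n , Pj , none′
  where
  none′ : ∀ m → j < m → m < suc n → ¬ _
  none′ m j<m m≤n Pm with m ℕ.≟ n
  ... | yes refl = ¬Pn Pm
  ... | no m≢n = none m j<m (≤∧≢⇒< (≤-pred m≤n) m≢n) Pm

least : {P : ℕ → Set p} → Decidable P → ∀ {n} → P n → ∃[ m ] m ≤ n × P m × (∀ j → j < m → ¬ P j)
least {P = P} P? {zero} P0 = 0 , z≤n , P0 , λ _ ()
least {P = P} P? {suc n} Pn with P? 0
... | yes P0 = 0 , z≤n , P0 , λ _ ()
... | no ¬P0 with least {P = P ∘ suc} (P? ∘ suc) Pn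
... | m , m≤n , Pm , none = suc m , s≤s m≤n , Pm , λ { zero _ → ¬P0 ; (suc j) (s≤s j<m) → none j j<m }

module Occurrence {a} {A : Set a} (u : InfiniteWord A) where

  length-segment : ∀ i n → length (segment u i n) ≡ n
  length-segment i = length-applyUpTo _

  segment-+ : ∀ i m n → segment u i (m + n) ≡ segment u i m ++ segment u (i + m) n
  segment-+ i m n = trans (applyUpTo-+ _ m n)
    (cong (segment u i m ++_) (applyUpTo-cong (λ j → cong u (sym (+-assoc i m j))) n))

  OccursAt-segment : ∀ i n → OccursAt u (segment u i n) i
  OccursAt-segment i n = cong (segment u i) (length-segment i n)

  OccursAt-++⁻ : ∀ {v w i} → OccursAt u (v ++ w) i → OccursAt u v i × OccursAt u w (i + length v)
  OccursAt-++⁻ {v} {w} {i} occ = split-≡ˡ _ v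
    (trans (sym (segment-+ i (length v) (length w))) (trans (cong (segment u i) (sym (length-++ v))) occ))
    (length-segment i (length v))

  OccursAt-++⁺ : ∀ {v w i} → OccursAt u v i → OccursAt u w (i + length v) → OccursAt u (v ++ w) i
  OccursAt-++⁺ {v} {w} {i} occᵛ occʷ =
    trans (cong (segment u i) (length-++ v)) (trans (segment-+ i (length v) (length w)) (cong₂ _++_ occᵛ occʷ))

  OccursAt-unique : ∀ {v w i} → OccursAt u v i → OccursAt u w i → length v ≡ length w → v ≡ w
  OccursAt-unique {i = i} occᵛ occʷ eq = trans (sym occᵛ) (trans (cong (segment u i) eq) occʷ)

  OccursAt-prefix : ∀ {v w i} → OccursAt u v i → OccursAt u w i → length v ≤ length w → ∃[ d ] w ≡ v ++ d
  OccursAt-prefix {v} {w} {i} occᵛ occʷ le with m≤n⇒∃[o]m+o≡n le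
  ... | o , eq = segment u (i + length v) o , (begin
    w                                                  ≡⟨ occʷ ⟨
    segment u i (length w)                             ≡⟨ cong (segment u i) eq ⟨
    segment u i (length v + o)                         ≡⟨ segment-+ i (length v) o ⟩
    segment u i (length v) ++ segment u (i + length v) o ≡⟨ cong (_++ segment u (i + length v) o) occᵛ ⟩
    v ++ segment u (i + length v) o                    ∎)
    where open ≡-Reasoning

  OccursAt-factor : ∀ {w f i} m → OccursAt u f i → OccursAt u w (i + m) → m + length w ≤ length f →
    ∃₂ λ c d → f ≡ c ++ w ++ d × length c ≡ m
  OccursAt-factor {w} {f} {i} m occᶠ occʷ le
    with OccursAt-prefix (OccursAt-++⁺ {segment u i m} {w} (OccursAt-segment i m)
           (subst (λ n → OccursAt u w (i + n)) (sym (length-segment i m)) occʷ)) occᶠ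
           (≤-trans (≤-reflexive (trans (length-++ (segment u i m)) (cong (_+ length w) (length-segment i m)))) le)
  ... | d , eq = segment u i m , d , trans eq (++-assoc (segment u i m) w d) , length-segment i m

  Language-factor : ∀ c {w} d {f} → f ≡ c ++ w ++ d → Language u f → Language u w
  Language-factor c {w} d refl (i , occ) =
    i + length c , proj₁ (OccursAt-++⁻ {w} {d} (proj₂ (OccursAt-++⁻ {c} {w ++ d} occ)))

  Language-Factor : ∀ {w f} → Factor w f → Language u f → Language u w
  Language-Factor (c , d , eq) = Language-factor c d eq

  Prefix : List A → Set a
  Prefix f = OccursAt u f 0

  Prefix-compare : ∀ {v w} → Prefix v → Prefix w → (∃[ d ] w ≡ v ++ d) ⊎ (∃[ d ] v ≡ w ++ d)
  Prefix-compare {v} {w} pv pw with ≤-total (length v) (length w)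
  ... | inj₁ le = inj₁ (OccursAt-prefix pv pw le)
  ... | inj₂ ge = inj₂ (OccursAt-prefix pw pv ge)

  Prefix-init : ∀ {v w f} → f ≡ v ++ w → Prefix f → Prefix v
  Prefix-init {v} {w} refl pf = proj₁ (OccursAt-++⁻ {v} {w} pf)

  Language⇒Prefix : ∀ {w} → Language u w → ∃[ h ] Prefix (h ++ w)
  Language⇒Prefix {w} (i , occ) = segment u 0 i ,
    OccursAt-++⁺ (OccursAt-segment 0 i) (subst (OccursAt u w) (sym (length-segment 0 i)) occ)

  Prefix⇒Language : ∀ {h w} → Prefix (h ++ w) → Language u w
  Prefix⇒Language {h} {w} p = length h , proj₂ (OccursAt-++⁻ {h} {w} p)

  -- Return words without positions: `v ++ w` is the complete return word, and the last clause
  -- allows `w` in it only as a prefix or a suffix. This form can be reversed and split.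
  CompleteReturn : List A → List A → Set a
  CompleteReturn w v = v ≢ [] × Language u (v ++ w) × (∃[ d ] v ++ w ≡ w ++ d) ×
    (∀ c d → v ++ w ≡ c ++ w ++ d → c ≡ [] ⊎ d ≡ [])

  ReturnWord⇔CompleteReturn : ∀ w v → ReturnWord u w v ⇔ CompleteReturn w v
  ReturnWord⇔CompleteReturn w v = mk⇔ to from
    where
    to : ReturnWord u w v → CompleteReturn w v
    to (i , j , (i<j , occᵢ , occⱼ , none) , refl) = nonempty , (i , occ) , prefix , inner
      where
      n = j ∸ i
      i+n≡j : i + n ≡ j
      i+n≡j = m+[n∸m]≡n (<⇒≤ i<j)
      nonempty : segment u i n ≢ []
      nonempty eq = <-irrefl (sym (trans (sym (length-segment i n)) (cong length eq))) (m<n⇒0<n∸m i<j)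
      occ : OccursAt u (segment u i n ++ w) i
      occ = OccursAt-++⁺ (OccursAt-segment i n)
        (subst (OccursAt u w) (trans (sym i+n≡j) (cong (i +_) (sym (length-segment i n)))) occⱼ)
      prefix = OccursAt-prefix occᵢ occ (length-++-≤ʳ w {segment u i n})
      inner : ∀ c d → segment u i n ++ w ≡ c ++ w ++ d → c ≡ [] ⊎ d ≡ []
      inner c d eq with []? c | []? d
      ... | yes c≡[] | _ = inj₁ c≡[]
      ... | _ | yes d≡[] = inj₂ d≡[]
      ... | no c≢[] | no d≢[] = ⊥-elim (none (i + length c)
        (m<m+n i (length-≢[] c≢[]))
        (subst (i + length c <_) i+n≡j (+-monoʳ-< i short))
        (proj₁ (OccursAt-++⁻ {w} {d} (proj₂ (OccursAt-++⁻ {c} {w ++ d} (subst (λ f → OccursAt u f i) eq occ))))))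
        where
        short : length c < n
        short with split-≤ʳ c {w ++ d} (segment u i n) {w} (sym eq) (length-++-≤ˡ w)
        ... | e , eq′ , eq″ = subst (length c <_)
          (trans (sym (trans (cong length eq′) (length-++ c))) (length-segment i n))
          (m<m+n (length c) (length-≢[] e≢[]))
          where
          e≢[] : e ≢ []
          e≢[] refl = d≢[] (++-selfʳ w (sym eq″))
    from : CompleteReturn w v → ReturnWord u w v
    from (v≢[] , (i , occ) , (d , eq) , inner) =
      i , i + length v , (m<m+n i (length-≢[] v≢[]) ,
        proj₁ (OccursAt-++⁻ {w} {d} (subst (λ f → OccursAt u f i) eq occ)) ,
        proj₂ (OccursAt-++⁻ {v} {w} occ) , none) ,
      trans (sym (proj₁ (OccursAt-++⁻ {v} {w} occ))) (cong (segment u i) (sym (m+n∸m≡n i (length v))))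
      where
      none : ∀ m → i < m → m < i + length v → ¬ OccursAt u w m
      none m i<m m<j occₘ with m≤n⇒∃[o]m+o≡n (<⇒≤ i<m)
      ... | o , refl with OccursAt-factor {w} {v ++ w} o occ occₘ
              (≤-trans (+-monoˡ-≤ (length w) (<⇒≤ (+-cancelˡ-< i o _ m<j))) (≤-reflexive (sym (length-++ v))))
      ... | c , d , eq′ , refl with inner c d eq′
      ... | inj₁ refl = <-irrefl (sym (+-identityʳ i)) i<m
      ... | inj₂ refl = <-irrefl (cong (λ x → i + length x)
        (proj₁ (split-≡ʳ c v (trans (cong (c ++_) (sym (++-identityʳ w))) (sym eq′)) refl))) m<j

  module _ (_≟A_ : DecidableEquality A) (ur : UniformlyRecurrent u) where

    OccursAt? : ∀ w i → Dec (OccursAt u w i)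
    OccursAt? w i = ≡-dec _≟A_ _ _

    -- Recurrence promises only a second occurrence. Applied to the prefix of u ending with the
    -- occurrence of `w` at j, it yields a copy of that prefix starting at 1 or later, hence `w`
    -- beyond j.
    recurs-beyond : ∀ {w} → Language u w → ∀ n → ∃[ j ] n ≤ j × OccursAt u w j
    recurs-beyond (i , occ) zero = i , z≤n , occ
    recurs-beyond {w} L (suc n) with recurs-beyond L n
    ... | j , n≤j , occ with proj₁ ur (segment u 0 j ++ w) (0 , occ₀)
      where
      occ₀ : OccursAt u (segment u 0 j ++ w) 0
      occ₀ = OccursAt-++⁺ (OccursAt-segment 0 j) (subst (OccursAt u w) (sym (length-segment 0 j)) occ)
    ... | i₁ , i₂ , i₁<i₂ , _ , occ₂ = i₂ + length (segment u 0 j) ,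
      ≤-trans (s≤s n≤j) (subst (λ m → suc j ≤ i₂ + m) (sym (length-segment 0 j))
        (+-monoˡ-≤ j (≤-trans (s≤s z≤n) i₁<i₂))) ,
      proj₂ (OccursAt-++⁻ {segment u 0 j} {w} occ₂)

    next-occurrence : ∀ {w} → Language u w → ∀ n →
      ∃[ j ] n ≤ j × OccursAt u w j × (∀ m → n ≤ m → m < j → ¬ OccursAt u w m)
    next-occurrence {w} L n with recurs-beyond L n
    ... | j , n≤j , occ with m≤n⇒∃[o]m+o≡n n≤j
    ... | o , refl with least {P = λ m → OccursAt u w (n + m)} (λ m → OccursAt? w (n + m)) occ
    ... | m , _ , occₘ , none = n + m , m≤m+n n m , occₘ , none′
      where
      none′ : ∀ k → n ≤ k → k < n + m → ¬ OccursAt u w k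
      none′ k n≤k k< with m≤n⇒∃[o]m+o≡n n≤k
      ... | l , refl = none l (+-cancelˡ-< n l m k<)

    -- The gap bound `N` needs an occurrence on the left, hence the summand `i`: from a start at or
    -- before i the occurrence at i is within reach, and a later start lies in a gap between two
    -- occurrences.
    occurs-within : ∀ {w} → Language u w → ∃[ B ] ∀ n → ∃[ m ] m ≤ B × OccursAt u w (n + m)
    occurs-within {w} L@(i , occ) with proj₂ ur w L
    ... | N , bound = i + N , within
      where
      within : ∀ n → ∃[ m ] m ≤ i + N × OccursAt u w (n + m)
      within n with n ≤? i
      ... | yes n≤i with m≤n⇒∃[o]m+o≡n n≤i
      ... | o , refl = o , ≤-trans (m≤n+m o n) (m≤m+n (n + o) N) , occ
      within n | no n≰i with nearest-below (OccursAt? w) (≰⇒> n≰i) occ | next-occurrence L n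
      ... | j , _ , j<n , occⱼ , none | l , n≤l , occₗ , none′ with m≤n⇒∃[o]m+o≡n n≤l
      ... | o , refl = o , ≤-trans small (m≤n+m N i) , occₗ
        where
        gap : n + o ∸ j ≤ N
        gap = bound j (n + o) (≤-trans j<n (m≤m+n n o) , occⱼ , occₗ , between)
          where
          between : ∀ m → j < m → m < n + o → ¬ OccursAt u w m
          between m j<m m<l with m <? n
          ... | yes m<n = none m j<m m<n
          ... | no m≮n = none′ m (≮⇒≥ m≮n) m<l
        small : o ≤ N
        small = ≤-trans (subst (_≤ n + o ∸ j) (m+n∸m≡n n o) (∸-monoʳ-≤ (n + o) (<⇒≤ j<n))) gap

    factor-of-long : ∀ {w} → Language u w → ∃[ B ] ∀ f → Language u f → B ≤ length f → Factor w f
    factor-of-long {w} L with occurs-within L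
    ... | B , within = B + length w , λ f (i , occ) le →
      let m , m≤B , occₘ = within i
          c , d , eq , _ = OccursAt-factor {w} {f} m occ occₘ (≤-trans (+-monoˡ-≤ (length w) m≤B) le)
      in c , d , eq

-- Mirror returns and palindromic suffixes

module _ {a} {A : Set a} where

  factor-∷ʳ : ∀ c x d {f z} → d ≢ [] → f ∷ʳ z ≡ c ++ x ++ d → Factor {A = A} x f
  factor-∷ʳ c x d d≢[] eq with initLast d
  ... | [] = ⊥-elim (d≢[] refl)
  ... | d′ ∷ʳ′ z = c , d′ , ∷ʳ-injectiveˡ _ _ (begin
    _ ∷ʳ _                     ≡⟨ eq ⟩
    c ++ x ++ d′ ∷ʳ z          ≡⟨ cong (c ++_) (++-assoc x d′ [ z ]) ⟨
    c ++ (x ++ d′) ∷ʳ z        ≡⟨ ++-assoc c (x ++ d′) [ z ] ⟨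
    (c ++ x ++ d′) ∷ʳ z        ∎)
    where open ≡-Reasoning

  Factor-∷ʳ⇒ : ∀ {x f} z → Factor {A = A} x f → ∃₂ λ c d → d ≢ [] × f ∷ʳ z ≡ c ++ x ++ d
  Factor-∷ʳ⇒ {x} z (c , d , refl) = c , d ∷ʳ z , ++-≢[]ʳ d (λ ()) ,
    trans (++-assoc c (x ++ d) [ z ]) (cong (c ++_) (++-assoc x d [ z ]))

  Inner : List A → List A → Set a
  Inner w f = ∃₂ λ c d → c ≢ [] × d ≢ [] × f ≡ c ++ w ++ d

  Inner-wrap : ∀ {x q p p′} → Inner x (p ∷ (q ∷ʳ p′)) → Factor x q
  Inner-wrap ([] , _ , c≢[] , _) = ⊥-elim (c≢[] refl)
  Inner-wrap {x} (_ ∷ c , d , _ , d≢[] , eq) = factor-∷ʳ c x d d≢[] (∷-injectiveʳ eq)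

  Palindrome-wrap : ∀ {p c} → Palindrome {A = A} p → Palindrome (c ∷ (p ∷ʳ c))
  Palindrome-wrap {p} {c} pal = trans (unfold-reverse c (p ∷ʳ c))
    (cong (_∷ʳ c) (trans (reverse-++ p [ c ]) (cong (c ∷_) pal)))

  Palindrome-unwrap : ∀ {p c d} → Palindrome {A = A} (c ∷ (p ∷ʳ d)) → c ≡ d × Palindrome p
  Palindrome-unwrap {p} {c} {d} pal
    with ∷-injective (trans (sym (trans (unfold-reverse c (p ∷ʳ d)) (cong (_∷ʳ c) (reverse-++ p [ d ])))) pal)
  ... | d≡c , eq = sym d≡c , ∷ʳ-injectiveˡ _ _ eq

  Factor-reverse : ∀ {w f} → Palindrome f → Factor {A = A} w f → Factor (reverse w) f
  Factor-reverse {w} pal (c , d , refl) = reverse d , reverse c , trans (sym pal) (reverse-++₃ c w d)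

  Mirror : List A → List A → Set a
  Mirror w x = x ≡ w ⊎ x ≡ reverse w

  Mirror-length : ∀ {w x} → Mirror w x → length x ≡ length w
  Mirror-length (inj₁ refl) = refl
  Mirror-length {w} (inj₂ refl) = length-reverse w

  Mirror-length₂ : ∀ {w x y} → Mirror w x → Mirror w y → length x ≡ length y
  Mirror-length₂ mx my = trans (Mirror-length mx) (sym (Mirror-length my))

  Mirror-reverse : ∀ {w x} → Mirror w x → Mirror w (reverse x)
  Mirror-reverse (inj₁ refl) = inj₂ refl
  Mirror-reverse (inj₂ refl) = inj₁ (reverse-involutive _)

  Mirror-relate : ∀ {w x y} → Mirror w x → Mirror w y → Mirror x y
  Mirror-relate (inj₁ refl) my = my
  Mirror-relate (inj₂ refl) (inj₁ refl) = inj₂ (sym (reverse-involutive _))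
  Mirror-relate (inj₂ refl) (inj₂ refl) = inj₁ refl

  Mirror-palindrome : ∀ {w x} → Palindrome w → Mirror w x → x ≡ w
  Mirror-palindrome pal (inj₁ eq) = eq
  Mirror-palindrome pal (inj₂ eq) = trans eq pal

  Mirror-Factor : ∀ {w x f} → Palindrome f → Mirror w x → Factor x f → Factor w f
  Mirror-Factor pal (inj₁ refl) fac = fac
  Mirror-Factor {w} {x} {f} pal (inj₂ refl) fac = subst (λ v → Factor v f) (reverse-involutive w) (Factor-reverse pal fac)

  -- For a palindrome w these are the complete returns to w; in general, the factors
  -- spanning two successive occurrences of the set {w, reverse w}.
  record MirrorReturn (w f : List A) : Set a where
    field
      initial : ∃₂ λ x d → Mirror w x × f ≡ x ++ d
      final   : ∃₂ λ c x → c ≢ [] × Mirror w x × f ≡ c ++ x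
      inner   : ∀ c x d → Mirror w x → f ≡ c ++ x ++ d → c ≡ [] ⊎ d ≡ []

  Earlier : List A → List A → Set a
  Earlier w f = ∃₂ λ c x → ∃[ d ] Mirror w x × d ≢ [] × f ≡ c ++ x ++ d

  module _ (_≟_ : DecidableEquality A) where

    Earlier? : ∀ w f → Dec (Earlier w f)
    Earlier? w f with initLast f
    ... | [] = no λ { (c , x , d , _ , d≢[] , eq) → ++-≢[]ʳ c (++-≢[]ʳ x d≢[]) (sym eq) }
    ... | g ∷ʳ′ z = map′
      (λ { (inj₁ fac) → let c , d , d≢[] , eq = Factor-∷ʳ⇒ z fac in c , w , d , inj₁ refl , d≢[] , eq
         ; (inj₂ fac) → let c , d , d≢[] , eq = Factor-∷ʳ⇒ z fac in c , reverse w , d , inj₂ refl , d≢[] , eq })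
      (λ { (c , x , d , inj₁ refl , d≢[] , eq) → inj₁ (factor-∷ʳ c x d d≢[] eq)
         ; (c , x , d , inj₂ refl , d≢[] , eq) → inj₂ (factor-∷ʳ c x d d≢[] eq) })
      (Factor? _≟_ w g ⊎-dec Factor? _≟_ (reverse w) g)

    -- Letters are deleted from the left as long as an earlier occurrence survives. When one more
    -- deletion would leave none, the remaining word starts with such an occurrence and has none
    -- inside.
    last-return : ∀ {w x} f g → Earlier w f → Mirror w x → f ≡ g ++ x →
      ∃₂ λ c r → ∃[ b ] f ≡ c ++ r × MirrorReturn w r × r ≡ b ++ x × b ≢ [] × g ≡ c ++ b
    last-return [] g (c , x , d , _ , d≢[] , eq) = ⊥-elim (++-≢[]ʳ c (++-≢[]ʳ x d≢[]) (sym eq))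
    last-return {w} {x} (p ∷ f) g earlier mx eq with Earlier? w f
    last-return {w} {x} (p ∷ f) [] _ mx refl | yes (c , y , d , my , d≢[] , eq) =
      ⊥-elim (<-irrefl refl (≤-trans (≤-reflexive (Mirror-length₂ mx my)) (Factor-length (c , d , eq))))
    last-return {w} {x} (p ∷ f) (_ ∷ g) _ mx refl | yes earlier′ with last-return f g earlier′ mx refl
    ... | c , r , b , eq , ret , eq′ , b≢[] , eq″ =
      p ∷ c , r , b , cong (p ∷_) eq , ret , eq′ , b≢[] , cong (p ∷_) eq″
    last-return {w} {x} (p ∷ f) g (_ ∷ c , y , d , my , d≢[] , eq′) mx eq | no ¬earlier =
      ⊥-elim (¬earlier (c , y , d , my , d≢[] , ∷-injectiveʳ eq′))
    last-return {w} {x} (p ∷ f) g ([] , y , d , my , d≢[] , eq′) mx eq | no ¬earlier =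
      [] , p ∷ f , g , refl , ret , eq , g≢[] , refl
      where
      g≢[] : g ≢ []
      g≢[] refl = d≢[] (proj₂ (split-≡ˡ y x {[]} (trans (sym eq′) (trans eq (sym (++-identityʳ x)))) (Mirror-length₂ my mx)))
      inner : ∀ c z d → Mirror w z → p ∷ f ≡ c ++ z ++ d → c ≡ [] ⊎ d ≡ []
      inner [] z d mz eq = inj₁ refl
      inner (_ ∷ c) z d mz eq with []? d
      ... | yes d≡[] = inj₂ d≡[]
      ... | no d≢[] = ⊥-elim (¬earlier (c , z , d , mz , d≢[] , ∷-injectiveʳ eq))
      ret : MirrorReturn w (p ∷ f)
      ret = record { initial = y , d , my , eq′ ; final = g , x , g≢[] , mx , eq ; inner = inner }

    longest-palindromic-suffix : ∀ f → ∃₂ λ c q → f ≡ c ++ q × Palindrome q ×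
      (∀ c′ s → f ≡ c′ ++ s → Palindrome s → ∃[ e ] c′ ≡ c ++ e)
    longest-palindromic-suffix [] = [] , [] , refl , refl , λ c′ _ _ _ → c′ , refl
    longest-palindromic-suffix (p ∷ f) with ≡-dec _≟_ (reverse (p ∷ f)) (p ∷ f)
    ... | yes pal = [] , p ∷ f , refl , pal , λ c′ _ _ _ → c′ , refl
    ... | no ¬pal with longest-palindromic-suffix f
    ... | c , q , refl , pal , longest = p ∷ c , q , refl , pal ,
      λ { [] s refl pal′ → ⊥-elim (¬pal pal′)
        ; (_ ∷ c′) s eq pal′ → let e , eq′ = longest c′ s (∷-injectiveʳ eq) pal′
                               in e , cong₂ _∷_ (sym (∷-injectiveˡ eq)) eq′ }

    -- A palindromic suffix shorter than the longest one, `q`, is reflected to a prefix of `q` and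
    -- so occurs before the last letter. Hence a letter adds at most one palindrome.
    palindromic-factor-∷ʳ : ∀ {v z x} c q → v ∷ʳ z ≡ c ++ q → Palindrome q →
      (∀ c′ s → v ∷ʳ z ≡ c′ ++ s → Palindrome s → ∃[ e ] c′ ≡ c ++ e) →
      Palindrome x → Factor x (v ∷ʳ z) → x ≡ q ⊎ Factor x v
    palindromic-factor-∷ʳ {v} {z} {x} c q eq palq longest palx (c′ , d , eq′) with []? d
    ... | no d≢[] = inj₂ (factor-∷ʳ c′ x d d≢[] eq′)
    ... | yes refl with longest c′ x (trans eq′ (cong (c′ ++_) (++-identityʳ x))) palx
    ... | e , refl with []? e
    ... | yes refl = inj₁ (sym (++-cancelˡ c _ _ (trans (sym eq)
            (trans eq′ (cong₂ _++_ (++-identityʳ c) (++-identityʳ x))))))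
    ... | no e≢[] = inj₂ (factor-∷ʳ c x (reverse e) (reverse-≢[] e≢[])
            (trans eq (cong (c ++_) q≡)))
      where
      q≡e++x : q ≡ e ++ x
      q≡e++x = ++-cancelˡ c _ _ (trans (sym eq) (trans eq′
        (trans (++-assoc c e (x ++ [])) (cong (λ t → c ++ e ++ t) (++-identityʳ x)))))
      q≡ : q ≡ x ++ reverse e
      q≡ = trans (palindrome-++ e palq q≡e++x) (cong (_++ reverse e) palx)

-- Richness as palindromicity of returns

module Richness {a} {A : Set a} (_≟_ : DecidableEquality A) (u : InfiniteWord A) where
  open Occurrence u

  Novel : List A → Set a
  Novel f = ∃₂ λ c q → f ≡ c ++ q × Palindrome q × (∀ c′ d → f ≡ c′ ++ q ++ d → d ≡ [])

  -- Had the longest palindromic suffix occurred before, the last letter would add no palindrome,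
  -- and |v| + 2 palindromes would fit among |v| + 1.
  Rich⇒Novel : Rich u → ∀ {f} → Language u f → f ≢ [] → Novel f
  Rich⇒Novel rich {f} L f≢[] with initLast f
  ... | [] = ⊥-elim (f≢[] refl)
  ... | v ∷ʳ′ z with longest-palindromic-suffix _≟_ (v ∷ʳ z)
  ... | c , q , eq , pal , longest = c , q , eq , pal , unioccurrent
    where
    unioccurrent : ∀ c′ d → v ∷ʳ z ≡ c′ ++ q ++ d → d ≡ []
    unioccurrent c′ d eq′ with []? d
    ... | yes d≡[] = d≡[]
    ... | no d≢[] = ⊥-elim (<-irrefl refl (≤-trans (≤-reflexive len)
        (HasExactly-mono (rich (v ∷ʳ z) L) (rich v (Language-factor [] [ z ] refl L)) old)))
      where
      len : suc (suc (length v)) ≡ suc (length (v ∷ʳ z))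
      len = cong suc (sym (trans (length-++ v) (+-comm (length v) 1)))
      old : ∀ {x} → Palindrome x × Infix _≡_ x (v ∷ʳ z) → Palindrome x × Infix _≡_ x v
      old (palx , inf) with palindromic-factor-∷ʳ _≟_ c q eq pal longest palx (Infix⇒Factor inf)
      ... | inj₁ refl = palx , Factor⇒Infix (factor-∷ʳ c′ q d d≢[] eq′)
      ... | inj₂ fac = palx , Factor⇒Infix fac

  -- The unioccurrent palindromic suffix `q` is compared with the final `x`. If `q` fits into `x`,
  -- the initial copy of `x` or its reversal contains `q` again. If `q` is longer, it starts with
  -- reverse x, which can only sit at the start of `f`, so `q` is all of `f`.
  Rich⇒MirrorReturn-palindrome : Rich u → ∀ {w f} → Language u f → MirrorReturn w f → Palindrome f
  Rich⇒MirrorReturn-palindrome rich {w} {f} L ret with MirrorReturn.initial ret | MirrorReturn.final ret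
  ... | y , b , my , eqʸ | g , x , g≢[] , mx , eqˣ
    with Rich⇒Novel rich L (λ f≡[] → ++-≢[]ˡ g≢[] (trans (sym eqˣ) f≡[]))
  ... | c , q , eq , pal , unioccurrent with length q ≤? length x
  ... | yes q≤x = ⊥-elim (repeated (split-≤ʳ g c (trans (sym eqˣ) eq) q≤x))
    where
    open ≡-Reasoning
    b≢[] : b ≢ []
    b≢[] refl = g≢[] (++-[]-length g x (≤-reflexive (begin
      length (g ++ x)    ≡⟨ cong length eqˣ ⟨
      length f           ≡⟨ cong length eqʸ ⟩
      length (y ++ [])   ≡⟨ cong length (++-identityʳ y) ⟩
      length y           ≡⟨ Mirror-length₂ my mx ⟩
      length x           ∎)))
    factor : ∀ e → x ≡ e ++ q → Factor q y
    factor e x≡e++q with Mirror-relate mx my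
    ... | inj₁ refl = e , [] , trans x≡e++q (cong (e ++_) (sym (++-identityʳ q)))
    ... | inj₂ refl = [] , reverse e , (begin
      reverse x                ≡⟨ cong reverse x≡e++q ⟩
      reverse (e ++ q)         ≡⟨ reverse-++ e q ⟩
      reverse q ++ reverse e   ≡⟨ cong (_++ reverse e) pal ⟩
      q ++ reverse e           ∎)
    repeated : ¬ (∃[ e ] c ≡ g ++ e × x ≡ e ++ q)
    repeated (e , _ , x≡e++q) with factor e x≡e++q
    ... | s , t , y≡sqt = ++-≢[]ʳ t b≢[] (unioccurrent s (t ++ b) (begin
      f                    ≡⟨ eqʸ ⟩
      y ++ b               ≡⟨ cong (_++ b) y≡sqt ⟩
      (s ++ q ++ t) ++ b   ≡⟨ ++-assoc s (q ++ t) b ⟩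
      s ++ (q ++ t) ++ b   ≡⟨ cong (s ++_) (++-assoc q t b) ⟩
      s ++ q ++ t ++ b     ∎))
  ... | no q≰x with split-≤ʳ c g (trans (sym eq) eqˣ) (<⇒≤ (≰⇒> q≰x))
  ... | e , refl , q≡e++x with MirrorReturn.inner ret c (reverse x) (reverse e) (Mirror-reverse mx)
          (trans eq (cong (c ++_) (palindrome-++ e pal q≡e++x)))
  ... | inj₁ refl = subst Palindrome (sym eq) pal
  ... | inj₂ rev-e≡[] with reverse-injective {x = e} {y = []} rev-e≡[]
  ... | refl = ⊥-elim (q≰x (≤-reflexive (cong length q≡e++x)))

  -- Induction on the last letter: if the longest palindromic suffix `q` had occurred before, the
  -- complete return to `q` ending the word would be a longer palindromic suffix. So each letter
  -- adds exactly one palindrome.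
  MirrorReturn-palindrome⇒Rich :
    (∀ {w f} → Language u w → Palindrome w → Language u f → MirrorReturn w f → Palindrome f) → Rich u
  MirrorReturn-palindrome⇒Rich returns-palindrome w = rich (reverseView w)
    where
    rich : ∀ {w} → Reverse w → Language u w →
      HasExactly (suc (length w)) (λ v → Palindrome v × Infix _≡_ v w)
    rich [] _ = [ [] ] , [] ∷ [] , refl , λ x →
      mk⇔ (λ { (here refl) → refl , Factor⇒Infix ([] , [] , refl) })
          (λ { (_ , inf) → here (length≤0 (Factor-length (Infix⇒Factor inf))) })
      where
      length≤0 : ∀ {x : List A} → length x ≤ 0 → x ≡ []
      length≤0 {[]} _ = refl
    rich (v ∶ rs ∶ʳ z) L with longest-palindromic-suffix _≟_ (v ∷ʳ z)
                            | rich rs (Language-factor [] [ z ] refl L)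
    ... | c , q , eq , pal , longest | xs , uniq , len , xs⇔ =
      q ∷ xs , All.tabulate fresh ∷ uniq ,
      cong suc (trans len (sym (trans (length-++ v) (+-comm (length v) 1)))) ,
      λ x → mk⇔ to from
      where
      novel : ¬ Factor q v
      novel fac with Factor-∷ʳ⇒ z fac
      ... | c₁ , d₁ , d₁≢[] , eq₁
        with last-return _≟_ (v ∷ʳ z) c (c₁ , q , d₁ , inj₁ refl , d₁≢[] , eq₁) (inj₁ refl) eq
      ... | c₂ , r , b , eq₂ , ret , eq₃ , b≢[] , eq₄
        with longest c₂ r eq₂ (returns-palindrome
               (Language-factor c [] (trans eq (cong (c ++_) (sym (++-identityʳ q)))) L) pal
               (Language-factor c₂ [] (trans eq₂ (cong (c₂ ++_) (sym (++-identityʳ r)))) L) ret)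
      ... | e , refl = ++-≢[]ʳ e b≢[] (++-selfʳ c (trans eq₄ (++-assoc c e b)))
      fresh : ∀ {y} → y ∈ xs → q ≢ y
      fresh y∈ refl = novel (Infix⇒Factor (proj₂ (Equivalence.to (xs⇔ q) y∈)))
      to : ∀ {x} → x ∈ q ∷ xs → Palindrome x × Infix _≡_ x (v ∷ʳ z)
      to (here refl) = pal , Factor⇒Infix (c , [] , trans eq (cong (c ++_) (sym (++-identityʳ q))))
      to (there x∈) with Equivalence.to (xs⇔ _) x∈
      ... | palx , inf = palx , Factor⇒Infix (Factor-trans (Infix⇒Factor inf) ([] , [ z ] , refl))
      from : ∀ {x} → Palindrome x × Infix _≡_ x (v ∷ʳ z) → x ∈ q ∷ xs
      from (palx , inf) with palindromic-factor-∷ʳ _≟_ c q eq pal longest palx (Infix⇒Factor inf)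
      ... | inj₁ x≡q = here x≡q
      ... | inj₂ fac = there (Equivalence.from (xs⇔ _) (palx , Factor⇒Infix fac))

-- Palindromes by centre and radius; hulls

module Centres {a} {A : Set a} (_≟_ : DecidableEquality A) (u : InfiniteWord A)
  (letters : EveryLetterOccurs u) (ur : UniformlyRecurrent u) (upe : UniquePalindromicExtensions u) where

  open Occurrence u
  open Richness _≟_ u

  private
    core : Maybe A → List A
    core nothing = []
    core (just c) = [ c ]

    core-Language : ∀ γ → Language u (core γ)
    core-Language nothing = 0 , refl
    core-Language (just c) with letters c
    ... | i , eq = i , cong [_] (trans (cong u (+-identityʳ i)) eq)

    core-Palindrome : ∀ γ → Palindrome (core γ)
    core-Palindrome nothing = refl
    core-Palindrome (just _) = refl

    node : Maybe A → ℕ → Σ[ p ∈ List A ] Language u p × Palindrome p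
    node γ zero = core γ , core-Language γ , core-Palindrome γ
    node γ (suc n) with node γ n
    ... | p , L , pal with upe p L pal
    ... | _ , (L′ , c , refl) , _ = c ∷ (p ∷ʳ c) , L′ , Palindrome-wrap pal

  -- A palindrome is encoded by its centre (nothing for even length, the middle letter
  -- for odd length) and its radius: unique extensions leave no other freedom.
  chain : Maybe A → ℕ → List A
  chain γ n = proj₁ (node γ n)

  chain-Language : ∀ γ n → Language u (chain γ n)
  chain-Language γ n = proj₁ (proj₂ (node γ n))

  chain-Palindrome : ∀ γ n → Palindrome (chain γ n)
  chain-Palindrome γ n = proj₂ (proj₂ (node γ n))

  chain-suc : ∀ γ n → ∃[ c ] chain γ (suc n) ≡ c ∷ (chain γ n ∷ʳ c)
  chain-suc γ n with node γ n
  ... | p , L , pal with upe p L pal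
  ... | _ , (L′ , c , refl) , _ = c , refl

  chain-extension : ∀ γ n {c} → Language u (c ∷ (chain γ n ∷ʳ c)) → chain γ (suc n) ≡ c ∷ (chain γ n ∷ʳ c)
  chain-extension γ n L with node γ n
  ... | p , Lp , pal with upe p Lp pal
  ... | _ , (_ , _ , refl) , unique = unique (L , _ , refl)

  -- Stripping both end letters descends to a centre; on the way back uniqueness of the extension
  -- forces each stage to be the next one in the chain.
  chain-complete : ∀ {p} → Language u p → Palindrome p → ∃₂ λ γ n → p ≡ chain γ n
  chain-complete {p} = bounded (length p) p ≤-refl
    where
    bounded : ∀ m p → length p ≤ m → Language u p → Palindrome p → ∃₂ λ γ n → p ≡ chain γ n
    bounded _ [] _ _ _ = nothing , 0 , refl
    bounded (suc m) (c ∷ p) (s≤s le) L pal with initLast p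
    ... | [] = just c , 0 , refl
    ... | q ∷ʳ′ d with Palindrome-unwrap {p = q} pal
    ... | refl , palq with bounded m q (≤-trans (length-++-≤ˡ q) le) (Language-factor [ c ] [ c ] refl L) palq
    ... | γ , n , refl = γ , suc n , sym (chain-extension γ n L)

  core≢chain-suc : ∀ γ γ′ n → core γ ≢ chain γ′ (suc n)
  core≢chain-suc γ γ′ n eq with chain-suc γ′ n
  ... | c , eq′ = core≢ γ (trans eq eq′)
    where
    core≢ : ∀ γ {c d p} → core γ ≢ c ∷ (p ∷ʳ d)
    core≢ nothing ()
    core≢ (just _) {p = []} ()
    core≢ (just _) {p = _ ∷ _} ()

  chain-injective : ∀ {γ γ′} m n → chain γ m ≡ chain γ′ n → γ ≡ γ′
  chain-injective {nothing} {nothing} zero zero _ = refl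
  chain-injective {just _} {just _} zero zero refl = refl
  chain-injective {γ} {γ′} zero (suc n) eq = ⊥-elim (core≢chain-suc γ γ′ n eq)
  chain-injective {γ} {γ′} (suc m) zero eq = ⊥-elim (core≢chain-suc γ′ γ m (sym eq))
  chain-injective {γ} {γ′} (suc m) (suc n) eq with chain-suc γ m | chain-suc γ′ n
  ... | c , eq₁ | d , eq₂ =
    chain-injective m n (∷ʳ-injectiveˡ _ _ (∷-injectiveʳ (trans (sym eq₁) (trans eq eq₂))))

  chain-Inner : ∀ γ {m n} → m < n → Inner (chain γ m) (chain γ n)
  chain-Inner γ {m} {suc n} (s≤s m≤n) with chain-suc γ n | m≤n⇒m<n∨m≡n m≤n
  ... | c , eq | inj₂ refl = [ c ] , [ c ] , (λ ()) , (λ ()) , eq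
  ... | c , eq | inj₁ m<n with chain-Inner γ m<n
  ... | d , e , _ , _ , eq′ = c ∷ d , e ∷ʳ c , (λ ()) , ++-≢[]ʳ e (λ ()) ,
    trans eq (cong (c ∷_) (trans (cong (_∷ʳ c) eq′)
      (trans (++-assoc d (chain γ m ++ e) [ c ]) (cong (d ++_) (++-assoc (chain γ m) e [ c ])))))

  Inner-length : ∀ {w f : List A} → Inner w f → length w < length f
  Inner-length {w} (c , d , c≢[] , _ , refl) = ≤-trans (s≤s (length-++-≤ˡ w))
    (≤-trans (+-monoˡ-≤ (length (w ++ d)) (length-≢[] c≢[])) (≤-reflexive (sym (length-++ c))))

  length-chain : ∀ γ n → n ≤ length (chain γ n)
  length-chain γ zero = z≤n
  length-chain γ (suc n) = ≤-trans (s≤s (length-chain γ n)) (Inner-length (chain-Inner γ (n<1+n n)))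

  -- Extensions never stop, so the palindromes of each centre grow without bound, and by uniform
  -- recurrence a long enough one contains `w`.
  Factor-chain : ∀ γ {w} → Language u w → ∃[ n ] Factor w (chain γ n)
  Factor-chain γ L with factor-of-long _≟_ ur L
  ... | B , long = B , long (chain γ B) (chain-Language γ B) (length-chain γ B)

  -- `w` lies in a palindrome of the language; the centre `nothing` is an arbitrary choice.
  reverse-Language : ∀ {w} → Language u w → Language u (reverse w)
  reverse-Language L with Factor-chain nothing L
  ... | n , fac = Language-Factor (Factor-reverse (chain-Palindrome nothing n) fac) (chain-Language nothing n)

  module Colours {w : List A} (L : Language u w) where

    private
      abstract
        minimal : ∀ γ → ∃[ m ] Factor w (chain γ m) × (∀ j → j < m → ¬ Factor w (chain γ j))
        minimal γ with Factor-chain γ L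
        ... | n , fac with least (λ m → Factor? _≟_ w (chain γ m)) {n} fac
        ... | m , _ , fac′ , none = m , fac′ , none

      radius : Maybe A → ℕ
      radius γ = proj₁ (minimal γ)

    hull : Maybe A → List A
    hull γ = chain γ (radius γ)

    hull-Language : ∀ γ → Language u (hull γ)
    hull-Language γ = chain-Language γ (radius γ)

    hull-Palindrome : ∀ γ → Palindrome (hull γ)
    hull-Palindrome γ = chain-Palindrome γ (radius γ)

    hull-injective : ∀ {γ γ′} → hull γ ≡ hull γ′ → γ ≡ γ′
    hull-injective {γ} {γ′} = chain-injective (radius γ) (radius γ′)

    Avoids : Maybe A → Set a
    Avoids γ = ∀ n → w ≢ chain γ n

    -- By minimality the palindrome one step smaller contains neither `w` nor its reversal, so no
    -- copy is interior to the hull. Thus `w` is a prefix or a suffix, and reflection provides the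
    -- other end; `Avoids` keeps the two ends from being the same occurrence.
    hull-MirrorReturn : ∀ {γ} → Avoids γ → MirrorReturn w (hull γ)
    hull-MirrorReturn {γ} avoids with minimal γ
    ... | m , (c , d , eq) , none = ends c d eq (inner c w d (inj₁ refl) eq)
      where
      pal = chain-Palindrome γ m
      not-inner : ∀ {x} n → Mirror w x → (∀ j → j < n → ¬ Factor w (chain γ j)) → ¬ Inner x (chain γ n)
      -- A core has at most one letter, too short for two nonempty margins.
      not-inner zero mx none inn = core-Inner γ inn
        where
        core-Inner : ∀ γ {x} → ¬ Inner x (core γ)
        core-Inner nothing (c , _ , c≢[] , _ , eq) = ++-≢[]ˡ c≢[] (sym eq)
        core-Inner (just _) ([] , _ , c≢[] , _) = c≢[] refl
        core-Inner (just _) {x} (_ ∷ c , d , _ , d≢[] , eq) =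
          ++-≢[]ʳ c (++-≢[]ʳ x d≢[]) (sym (∷-injectiveʳ eq))
      not-inner {x} (suc n) mx none inn with chain-suc γ n
      ... | p , eq = none n (n<1+n n) (Mirror-Factor (chain-Palindrome γ n) mx (Inner-wrap (subst (Inner x) eq inn)))
      inner : ∀ c x d → Mirror w x → chain γ m ≡ c ++ x ++ d → c ≡ [] ⊎ d ≡ []
      inner c x d mx eq with []? c | []? d
      ... | yes c≡[] | _ = inj₁ c≡[]
      ... | _ | yes d≡[] = inj₂ d≡[]
      ... | no c≢[] | no d≢[] = ⊥-elim (not-inner m mx none (c , d , c≢[] , d≢[] , eq))
      ends : ∀ c d → chain γ m ≡ c ++ w ++ d → c ≡ [] ⊎ d ≡ [] → MirrorReturn w (chain γ m)
      ends _ d eq (inj₁ refl) = record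
        { initial = w , d , inj₁ refl , eq
        ; final = reverse d , reverse w , reverse-≢[] d≢[] , inj₂ refl , palindrome-++ w pal eq
        ; inner = inner }
        where
        d≢[] : d ≢ []
        d≢[] refl = avoids m (sym (trans eq (++-identityʳ w)))
      ends c _ eq (inj₂ refl) = record
        { initial = reverse w , reverse c , inj₂ refl , palindrome-++ c pal eq′
        ; final = c , w , c≢[] , inj₁ refl , eq′
        ; inner = inner }
        where
        eq′ : chain γ m ≡ c ++ w
        eq′ = trans eq (cong (c ++_) (++-identityʳ w))
        c≢[] : c ≢ []
        c≢[] refl = avoids m (sym eq′)

    MirrorReturn-not-Inner : ∀ {f x} → MirrorReturn w f → Mirror w x → ¬ Inner x f
    MirrorReturn-not-Inner {x = x} ret mx (c , d , c≢[] , d≢[] , eq) with MirrorReturn.inner ret c x d mx eq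
    ... | inj₁ c≡[] = c≢[] c≡[]
    ... | inj₂ d≡[] = d≢[] d≡[]

    -- A palindromic return is the first member of its chain containing `w`, since a smaller member
    -- containing `w` would make `w` interior. Likewise `w` is no member: a smaller one is interior
    -- to the return, and any other is too long.
    MirrorReturn⇒hull : ∀ {f} → Language u f → Palindrome f → MirrorReturn w f → ∃[ γ ] f ≡ hull γ × Avoids γ
    MirrorReturn⇒hull Lf pal ret with chain-complete Lf pal
    ... | γ , n , refl with minimal γ in mineq
    ... | m , (c , d , eq) , none = γ , sym hull≡ , avoids
      where
      fac : Factor w (chain γ n)
      fac with MirrorReturn.initial ret
      ... | x , d , mx , eq = Mirror-Factor pal mx ([] , d , eq)
      m≡n : m ≡ n
      m≡n with <-cmp m n
      ... | tri≈ _ eq _ = eq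
      ... | tri> _ _ n<m = ⊥-elim (none n n<m fac)
      ... | tri< m<n _ _ with chain-Inner γ m<n
      ... | c′ , d′ , c′≢[] , d′≢[] , eq′ = ⊥-elim (MirrorReturn-not-Inner ret (inj₁ refl)
        (c′ ++ c , d ++ d′ , ++-≢[]ˡ c′≢[] , ++-≢[]ʳ d d′≢[] ,
          factorisation-trans c w c′ eq eq′))
      hull≡ : hull γ ≡ chain γ n
      hull≡ = cong (chain γ) (trans (cong proj₁ mineq) m≡n)
      avoids : Avoids γ
      avoids j w≡ with j <? n
      ... | yes j<n = MirrorReturn-not-Inner ret (inj₁ (sym w≡)) (chain-Inner γ j<n)
      ... | no j≮n with MirrorReturn.final ret
      ... | c , x , c≢[] , mx , eq = ⊥-elim (c≢[] (++-[]-length c x (≤-trans (≤-reflexive (cong length (sym eq)))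
        (≤-trans (length≤ (≮⇒≥ j≮n)) (≤-reflexive (trans (cong length (sym w≡)) (sym (Mirror-length mx))))))))
        where
        length≤ : n ≤ j → length (chain γ n) ≤ length (chain γ j)
        length≤ n≤j with m≤n⇒m<n∨m≡n n≤j
        ... | inj₁ n<j = <⇒≤ (Inner-length (chain-Inner γ n<j))
        ... | inj₂ refl = ≤-refl

  -- Return words of palindromes

  module PalindromicReturns {w : List A} (L : Language u w) (pal : Palindrome w)
    {k : ℕ} (alphabet : HasExactly k (λ (_ : A) → ⊤)) where

    open Colours L

    CompleteReturn⇒MirrorReturn : ∀ {v} → CompleteReturn w v → MirrorReturn w (v ++ w)
    CompleteReturn⇒MirrorReturn {v} (v≢[] , _ , (d , eq) , inner) = record
      { initial = w , d , inj₁ refl , eq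
      ; final = v , w , v≢[] , inj₁ refl , refl
      ; inner = λ c x d mx eq → inner c d (trans eq (cong (λ y → c ++ y ++ d) (Mirror-palindrome pal mx))) }

    MirrorReturn⇒CompleteReturn : ∀ {f} → Language u f → MirrorReturn w f → ∃[ v ] f ≡ v ++ w × CompleteReturn w v
    MirrorReturn⇒CompleteReturn Lf ret with MirrorReturn.initial ret | MirrorReturn.final ret
    ... | y , d , my , eqʸ | v , x , v≢[] , mx , eq with Mirror-palindrome pal mx | Mirror-palindrome pal my
    ... | refl | refl = v , eq , v≢[] , subst (Language u) eq Lf , (d , trans (sym eq) eqʸ) ,
      λ c d eq′ → MirrorReturn.inner ret c x d (inj₁ refl) (trans eq eq′)

    count : HasExactly k (λ v → CompleteReturn w v × Palindrome (v ++ w))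
    count with chain-complete L pal
    ... | γ₀ , n₀ , w≡ = HasExactly-bijection (λ γ v → v ++ w ≡ hull γ) total onto
      (λ eq eq′ → ++-cancelʳ w _ _ (trans eq (sym eq′)))
      (λ eq eq′ → hull-injective (trans (sym eq) eq′))
      (HasExactly-Maybe-≢ _≟_ alphabet γ₀)
      where
      total : ∀ {γ} → γ ≢ γ₀ → ∃[ v ] v ++ w ≡ hull γ × CompleteReturn w v × Palindrome (v ++ w)
      total {γ} γ≢γ₀ with MirrorReturn⇒CompleteReturn (hull-Language γ)
            (hull-MirrorReturn (λ n eq → γ≢γ₀ (chain-injective n n₀ (trans (sym eq) w≡))))
      ... | v , eq , ret = v , sym eq , ret , subst Palindrome eq (hull-Palindrome γ)
      onto : ∀ {v} → CompleteReturn w v × Palindrome (v ++ w) → ∃[ γ ] γ ≢ γ₀ × v ++ w ≡ hull γ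
      onto (ret@(_ , Lv , _) , palv) with MirrorReturn⇒hull Lv palv (CompleteReturn⇒MirrorReturn ret)
      ... | γ , eq , avoids = γ , (λ { refl → avoids n₀ w≡ }) , eq

    MirrorReturn-palindrome : HasExactly k (CompleteReturn w) → ∀ {f} → Language u f →
      MirrorReturn w f → Palindrome f
    MirrorReturn-palindrome exactly-k Lf ret with MirrorReturn⇒CompleteReturn Lf ret
    ... | v , refl , complete = proj₂ (HasExactly-saturated (≡-dec _≟_) count exactly-k proj₁ complete)

    Rich⇒count : Rich u → HasExactly k (CompleteReturn w)
    Rich⇒count rich = HasExactly-cong (λ v → mk⇔ proj₁
      (λ ret@(_ , Lv , _) → ret , Rich⇒MirrorReturn-palindrome rich Lv (CompleteReturn⇒MirrorReturn ret))) count

-- The copies have equal length, so one that starts before the common `x` lies in the left return,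
-- and any other lies in the right one. Each return admits copies only at its two ends.
MirrorReturn-junction : {w x y s t : List A} (c : List A) {d : List A} →
  MirrorReturn w (s ++ x) → MirrorReturn w (x ++ t) → Mirror w x → Mirror w y →
  s ++ x ++ t ≡ c ++ y ++ d → c ≡ [] ⊎ d ≡ [] ⊎ (c ≡ s × y ≡ x × d ≡ t)
MirrorReturn-junction {x = x} {y} {s} {t} c {d} retˡ retʳ mx my eq with split-compare s c eq
... | inj₁ (e , refl , eq′) with MirrorReturn.inner retʳ e y d my eq′
... | inj₂ d≡[] = inj₂ (inj₁ d≡[])
... | inj₁ refl with split-≡ˡ x y eq′ (Mirror-length₂ mx my)
... | x≡y , t≡d = inj₂ (inj₂ (++-identityʳ s , sym x≡y , sym t≡d))
MirrorReturn-junction {x = x} {y} {s} {t} c {d} retˡ retʳ mx my eq | inj₂ (e , refl , eq′)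
  with split-≤ˡ y (e ++ x) (trans eq′ (sym (++-assoc e x t)))
         (≤-trans (≤-reflexive (Mirror-length₂ my mx)) (length-++-≤ʳ x {e}))
... | g , e++x≡y++g , d≡g++t
  with MirrorReturn.inner retˡ c y g my (trans (++-assoc c e x) (cong (c ++_) e++x≡y++g))
... | inj₁ c≡[] = inj₁ c≡[]
... | inj₂ refl with split-≡ʳ e [] (trans e++x≡y++g (++-identityʳ y)) (Mirror-length₂ mx my)
... | refl , x≡y = inj₂ (inj₂ (sym (++-identityʳ c) , sym x≡y , d≡g++t))

-- Return words of non-palindromes as edges between hulls

module NonPalindromicReturns {a} {A : Set a} (_≟_ : DecidableEquality A) (u : InfiniteWord A)
  (letters : EveryLetterOccurs u) (ur : UniformlyRecurrent u) (upe : UniquePalindromicExtensions u)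
  (rich : Rich u) {w : List A} (L : Language u w) (nonpal : ¬ Palindrome w)
  {k : ℕ} (alphabet : HasExactly k (λ (_ : A) → ⊤)) where

  open Occurrence u
  open Richness _≟_ u
  open Centres _≟_ u letters ur upe
  open Colours L

  hull-return : ∀ γ → MirrorReturn w (hull γ)
  hull-return γ = hull-MirrorReturn (λ n eq → nonpal (subst Palindrome (sym eq) (chain-Palindrome γ n)))

  return-Palindrome : ∀ {w f} → Language u f → MirrorReturn w f → Palindrome f
  return-Palindrome = Rich⇒MirrorReturn-palindrome rich

  return-hull : ∀ {f} → Language u f → MirrorReturn w f → ∃[ γ ] f ≡ hull γ
  return-hull Lf ret with MirrorReturn⇒hull Lf (return-Palindrome Lf ret) ret
  ... | γ , eq , _ = γ , eq

  Mirror-nonpalindrome : ∀ {x} → Mirror w x → x ≢ reverse x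
  Mirror-nonpalindrome (inj₁ refl) eq = nonpal (sym eq)
  Mirror-nonpalindrome (inj₂ refl) eq = nonpal (trans eq (reverse-involutive w))

  hull-init-≢[] : ∀ {γ s x} → Mirror w x → hull γ ≡ s ++ x → s ≢ []
  hull-init-≢[] {γ} {s} mx eq with MirrorReturn.final (hull-return γ)
  ... | c , y , c≢[] , my , eq′ = subst (_≢ []) (proj₁ (split-≡ʳ c s (trans (sym eq′) eq) (Mirror-length₂ my mx))) c≢[]

  hull-tail-≢[] : ∀ {γ x t} → Mirror w x → hull γ ≡ x ++ t → t ≢ []
  hull-tail-≢[] {γ} {x} mx eq refl =
    hull-init-≢[] {γ} (Mirror-reverse mx) (palindrome-++ x (hull-Palindrome γ) eq) refl

  -- Reflection turns the final `x` into an initial reverse x, which differs from `x`. This is the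
  -- alternation of w and reverse w along u.
  hull-ends-differ : ∀ {γ x s t} → Mirror w x → hull γ ≡ s ++ x → hull γ ≢ x ++ t
  hull-ends-differ {γ} {x} {s} mx eqˢ eqᵗ = Mirror-nonpalindrome mx
    (proj₁ (split-≡ˡ x (reverse x) (trans (sym eqᵗ) (palindrome-++ s (hull-Palindrome γ) eqˢ)) (sym (length-reverse x))))

  -- One step of the walk: hull `γ` followed by hull `π`, overlapping exactly in `x`. Reversal gives
  -- the step back, with overlap reverse x.
  Junction : List A → Maybe A → Maybe A → List A → Set a
  Junction x γ π g = ∃₂ λ s t → hull γ ≡ s ++ x × hull π ≡ x ++ t × g ≡ s ++ x ++ t

  Junction-reverse : ∀ {x γ π g} → Junction x γ π g → Junction (reverse x) π γ (reverse g)
  Junction-reverse {x} {γ} {π} (s , t , eqᵞ , eqᵖ , refl) = reverse t , reverse s ,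
    palindrome-++ x (hull-Palindrome π) eqᵖ , palindrome-++ s (hull-Palindrome γ) eqᵞ , reverse-++₃ s x t

  Junction-inner : ∀ {x y γ π s t} c {d} → Mirror w x → Mirror w y → hull γ ≡ s ++ x → hull π ≡ x ++ t →
    s ++ x ++ t ≡ c ++ y ++ d → c ≡ [] ⊎ d ≡ [] ⊎ (c ≡ s × y ≡ x × d ≡ t)
  Junction-inner {γ = γ} {π} c mx my eqᵞ eqᵖ = MirrorReturn-junction c
    (subst (MirrorReturn w) eqᵞ (hull-return γ)) (subst (MirrorReturn w) eqᵖ (hull-return π)) mx my

  -- An edge as seen inside v w. The overlap is reverse w, so that hull `γ` starts with w and hull
  -- `π` ends with w.
  Passage : List A → Maybe A → Maybe A → Set a
  Passage v γ π = Junction (reverse w) γ π (v ++ w) × Language u (v ++ w)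

  Passage⇒CompleteReturn : ∀ {v γ π} → Passage v γ π → CompleteReturn w v
  Passage⇒CompleteReturn {v} {γ} {π} ((s , t , eqᵞ , eqᵖ , eq) , Lv) =
    v≢[] , Lv , (reverse s ++ t , prefix) , inner
    where
    open ≡-Reasoning
    mx : Mirror w (reverse w)
    mx = inj₂ refl
    v≢[] : v ≢ []
    v≢[] refl = hull-init-≢[] {γ} mx eqᵞ (++-conicalˡ s t (++-[]-length (s ++ t) w (≤-reflexive len)))
      where
      len : length ((s ++ t) ++ w) ≡ length w
      len = begin
        length ((s ++ t) ++ w)                        ≡⟨ cong length (++-assoc s t w) ⟩
        length (s ++ t ++ w)                          ≡⟨ length-++ s ⟩
        length s + length (t ++ w)                    ≡⟨ cong (length s +_) (length-++-comm t w) ⟩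
        length s + length (w ++ t)                    ≡⟨ cong (length s +_) (length-++ w) ⟩
        length s + (length w + length t)              ≡⟨ cong (λ n → length s + (n + length t)) (length-reverse w) ⟨
        length s + (length (reverse w) + length t)    ≡⟨ cong (length s +_) (length-++ (reverse w)) ⟨
        length s + length (reverse w ++ t)            ≡⟨ length-++ s ⟨
        length (s ++ reverse w ++ t)                  ≡⟨ cong length eq ⟨
        length w                                      ∎
    prefix : v ++ w ≡ w ++ reverse s ++ t
    prefix = begin
      v ++ w                                  ≡⟨ eq ⟩
      s ++ reverse w ++ t                     ≡⟨ ++-assoc s (reverse w) t ⟨
      (s ++ reverse w) ++ t                   ≡⟨ cong (_++ t) eqᵞ ⟨
      hull γ ++ t                             ≡⟨ cong (_++ t) (palindrome-++ s (hull-Palindrome γ) eqᵞ) ⟩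
      (reverse (reverse w) ++ reverse s) ++ t ≡⟨ cong (λ x → (x ++ reverse s) ++ t) (reverse-involutive w) ⟩
      (w ++ reverse s) ++ t                   ≡⟨ ++-assoc w (reverse s) t ⟩
      w ++ reverse s ++ t                     ∎
    inner : ∀ c d → v ++ w ≡ c ++ w ++ d → c ≡ [] ⊎ d ≡ []
    inner c d eq′ with Junction-inner {γ = γ} {π} c mx (inj₁ refl) eqᵞ eqᵖ (trans (sym eq) eq′)
    ... | inj₁ c≡[] = inj₁ c≡[]
    ... | inj₂ (inj₁ d≡[]) = inj₂ d≡[]
    ... | inj₂ (inj₂ (_ , w≡ , _)) = ⊥-elim (nonpal (sym w≡))

  -- The last mirror return ends in w and, being a palindrome, starts with reverse w; the one before
  -- it ends there and starts with w. As v w has no interior w, this second return starts at the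
  -- very beginning.
  CompleteReturn⇒Passage : ∀ {v} → CompleteReturn w v → ∃₂ λ γ π → Passage v γ π
  CompleteReturn⇒Passage {v} (v≢[] , Lv , (d , eq) , inner)
    with last-return _≟_ (v ++ w) v ([] , w , d , inj₁ refl , d≢[] , eq) (inj₁ refl) refl
    where
    d≢[] : d ≢ []
    d≢[] refl = v≢[] (++-[]-length v w (≤-reflexive (cong length (trans eq (++-identityʳ w)))))
  ... | c , r , b , eqʳ , ret , refl , b≢[] , refl
    with Language-factor c [] (trans eqʳ (cong (c ++_) (sym (++-identityʳ r)))) Lv
  ... | Lr with palindrome-++ b (return-Palindrome Lr ret) refl
  ... | r≡ with split-≤ˡ w (c ++ reverse w) (trans (sym eq)
                  (trans eqʳ (trans (cong (c ++_) r≡) (sym (++-assoc c (reverse w) (reverse b))))))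
                  (≤-trans (≤-reflexive (sym (length-reverse w))) (length-++-≤ʳ (reverse w) {c}))
  ... | d′ , eq′ , _
    with last-return _≟_ (c ++ reverse w) c ([] , w , d′ , inj₁ refl , d′≢[] , eq′) (inj₂ refl) refl
    where
    d′≢[] : d′ ≢ []
    d′≢[] refl with split-≡ʳ c [] (trans eq′ (++-identityʳ w)) (length-reverse w)
    ... | _ , w≡ = nonpal w≡
  ... | c₂ , r₂ , b₂ , eqʳ₂ , ret₂ , refl , b₂≢[] , refl
    with Language-factor c₂ (reverse b) (trans eqʳ (trans (cong ((c₂ ++ b₂) ++_) r≡)
           (trans (++-assoc c₂ b₂ _) (cong (c₂ ++_) (sym (++-assoc b₂ (reverse w) (reverse b))))))) Lv
  ... | Lr₂ with inner c₂ (reverse b₂ ++ reverse b) split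
    where
    open ≡-Reasoning
    split : (( c₂ ++ b₂) ++ b) ++ w ≡ c₂ ++ w ++ reverse b₂ ++ reverse b
    split = begin
      ((c₂ ++ b₂) ++ b) ++ w                                  ≡⟨ eqʳ ⟩
      (c₂ ++ b₂) ++ b ++ w                                    ≡⟨ cong ((c₂ ++ b₂) ++_) r≡ ⟩
      (c₂ ++ b₂) ++ reverse w ++ reverse b                    ≡⟨ ++-assoc c₂ b₂ _ ⟩
      c₂ ++ b₂ ++ reverse w ++ reverse b                      ≡⟨ cong (c₂ ++_) (++-assoc b₂ (reverse w) (reverse b)) ⟨
      c₂ ++ (b₂ ++ reverse w) ++ reverse b                    ≡⟨ cong (λ f → c₂ ++ f ++ reverse b)
                                                                   (palindrome-++ b₂ (return-Palindrome Lr₂ ret₂) refl) ⟩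
      c₂ ++ (reverse (reverse w) ++ reverse b₂) ++ reverse b  ≡⟨ cong (λ x → c₂ ++ (x ++ reverse b₂) ++ reverse b)
                                                                   (reverse-involutive w) ⟩
      c₂ ++ (w ++ reverse b₂) ++ reverse b                    ≡⟨ cong (c₂ ++_) (++-assoc w (reverse b₂) (reverse b)) ⟩
      c₂ ++ w ++ reverse b₂ ++ reverse b                      ∎
  ... | inj₂ eq-[] = ⊥-elim (++-≢[]ˡ (reverse-≢[] b₂≢[]) eq-[])
  ... | inj₁ refl with return-hull Lr ret | return-hull Lr₂ ret₂
  ... | π , eqᵖ | γ , eqᵞ = γ , π ,
    (b₂ , reverse b , sym eqᵞ , trans (sym eqᵖ) r≡ , trans eqʳ (cong (b₂ ++_) r≡)) , Lv

  Junction⇒Passage : ∀ {γ π g} → Junction (reverse w) γ π g → Language u g → ∃[ v ] Passage v γ π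
  Junction⇒Passage {γ} {π} {g} (s , t , eqᵞ , eqᵖ , eq) Lg = s ++ reverse t ,
    (s , t , eqᵞ , eqᵖ , trans (sym eq′) eq) , subst (Language u) eq′ Lg
    where
    open ≡-Reasoning
    eq′ : g ≡ (s ++ reverse t) ++ w
    eq′ = begin
      g                                        ≡⟨ eq ⟩
      s ++ reverse w ++ t                      ≡⟨ cong (s ++_) eqᵖ ⟨
      s ++ hull π                              ≡⟨ cong (s ++_) (palindrome-++ (reverse w) (hull-Palindrome π) eqᵖ) ⟩
      s ++ reverse t ++ reverse (reverse w)    ≡⟨ cong (λ x → s ++ reverse t ++ x) (reverse-involutive w) ⟩
      s ++ reverse t ++ w                      ≡⟨ ++-assoc s (reverse t) w ⟨
      (s ++ reverse t) ++ w                    ∎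

  Passage-functional : ∀ {v v′ γ π} → Passage v γ π → Passage v′ γ π → v ≡ v′
  Passage-functional ((s , t , eqᵞ , eqᵖ , eq) , _) ((s′ , t′ , eqᵞ′ , eqᵖ′ , eq′) , _)
    with ++-cancelʳ (reverse w) s s′ (trans (sym eqᵞ) eqᵞ′) | ++-cancelˡ (reverse w) t t′ (trans (sym eqᵖ) eqᵖ′)
  ... | refl | refl = ++-cancelʳ w _ _ (trans eq (sym eq′))

  Passage-injective : ∀ {v γ π γ′ π′} → Passage v γ π → Passage v γ′ π′ → γ ≡ γ′ × π ≡ π′
  Passage-injective {γ = γ} {π} {γ′} {π′} ((s , t , eqᵞ , eqᵖ , eq) , _) ((s′ , t′ , eqᵞ′ , eqᵖ′ , eq′) , _)
    with Junction-inner {γ = γ} {π} s′ (inj₂ refl) (inj₂ refl) eqᵞ eqᵖ (trans (sym eq) eq′)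
  ... | inj₁ s′≡[] = ⊥-elim (hull-init-≢[] {γ′} (inj₂ refl) eqᵞ′ s′≡[])
  ... | inj₂ (inj₁ t′≡[]) = ⊥-elim (hull-tail-≢[] {π′} (inj₂ refl) eqᵖ′ t′≡[])
  ... | inj₂ (inj₂ (refl , _ , refl)) = hull-injective (trans eqᵞ (sym eqᵞ′)) , hull-injective (trans eqᵖ (sym eqᵖ′))

  -- A hull ending with reverse w starts with w, so it cannot also start with reverse w.
  Passage-asymmetric : ∀ {v v′ γ π} → Passage v γ π → ¬ Passage v′ π γ
  Passage-asymmetric {γ = γ} ((_ , _ , eq , _) , _) ((_ , _ , _ , eq′ , _) , _) = hull-ends-differ {γ} (inj₂ refl) eq eq′

  -- First occurrences, recorded as prefixes of u; parents and the root

  FirstEnding : List A → List A → Set a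
  FirstEnding z p = Prefix p × (∃[ h ] p ≡ h ++ z) × (∀ c d → p ≡ c ++ z ++ d → d ≡ [])

  FirstEnding-≤ : ∀ {z p h} → FirstEnding z p → Prefix (h ++ z) → length p ≤ length (h ++ z)
  FirstEnding-≤ {z} {p} {h} (pp , _ , first) pq with Prefix-compare pp pq
  ... | inj₁ (d , eq) = ≤-trans (length-++-≤ˡ p) (≤-reflexive (cong length (sym eq)))
  ... | inj₂ (d , eq) with first h d (trans eq (++-assoc h z d))
  ... | refl = ≤-reflexive (cong length (trans eq (++-identityʳ _)))

  FirstEnding-unique : ∀ {z p q} → FirstEnding z p → FirstEnding z q → p ≡ q
  FirstEnding-unique fp@(pp , (h , refl) , _) fq@(pq , (h′ , refl) , _) =
    OccursAt-unique pp pq (≤-antisym (FirstEnding-≤ fp pq) (FirstEnding-≤ fq pp))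

  not-earlier⇒FirstEnding : ∀ {z h p} → Prefix p → p ≡ h ++ z → ¬ Earlier z p → FirstEnding z p
  not-earlier⇒FirstEnding {z} {h} {p} pp eq ¬earlier = pp , (h , eq) , first
    where
    first : ∀ c d → p ≡ c ++ z ++ d → d ≡ []
    first c d eq′ with []? d
    ... | yes d≡[] = d≡[]
    ... | no d≢[] = ⊥-elim (¬earlier (c , z , d , inj₁ refl , d≢[] , eq′))

  length-prefix-< : ∀ p {d : List A} → d ≢ [] → length p < length (p ++ d)
  length-prefix-< p d≢[] = ≤-trans (m<m+n (length p) (length-≢[] d≢[])) (≤-reflexive (sym (length-++ p)))

  -- A prefix ending with `z` is shortened until no earlier occurrence is left. `Earlier?` looks for
  -- `z` or its reversal, which is `z` alone for a palindrome.
  FirstEnding-exists : ∀ {z} → Palindrome z → Language u z → ∃[ p ] FirstEnding z p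
  FirstEnding-exists {z} pal Lz with Language⇒Prefix Lz
  ... | h , pp = search _ h pp ≤-refl
    where
    search : ∀ n h → Prefix (h ++ z) → length (h ++ z) ≤ n → ∃[ p ] FirstEnding z p
    search n h pp le with Earlier? _≟_ z (h ++ z)
    ... | no ¬earlier = h ++ z , not-earlier⇒FirstEnding pp refl ¬earlier
    ... | yes (c , x , d , mx , d≢[] , eq) with Mirror-palindrome pal mx
    search n h pp le | yes (c , x , d , mx , d≢[] , eq) | refl with trans eq (sym (++-assoc c x d))
    search zero h pp le | yes (c , x , d , mx , d≢[] , eq) | refl | eq′ =
      ⊥-elim (<-irrefl refl (≤-trans (length-prefix-< (c ++ x) d≢[])
        (≤-trans (≤-reflexive (cong length (sym eq′))) (≤-trans le z≤n))))
    search (suc n) h pp le | yes (c , x , d , mx , d≢[] , eq) | refl | eq′ =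
      search n c (Prefix-init eq′ pp)
        (≤-pred (≤-trans (length-prefix-< (c ++ x) d≢[]) (≤-trans (≤-reflexive (cong length (sym eq′))) le)))

  first : ∀ γ → ∃[ p ] FirstEnding (hull γ) p
  first γ = FirstEnding-exists (hull-Palindrome γ) (hull-Language γ)

  -- The parent is the hull traversed just before the first occurrence of the hull of γ.
  Parent : Maybe A → Maybe A → Set a
  Parent γ π = ∃₂ λ x p → ∃₂ λ c g →
    Mirror w x × FirstEnding (hull γ) p × p ≡ c ++ g × Junction x π γ g

  -- The first hull on the walk: the `x` at its start is the first copy of w or reverse w in u.
  Root : Maybe A → Set a
  Root γ = ∃₂ λ x h → ∃[ t ] Mirror w x × FirstEnding (hull γ) (h ++ x ++ t) × hull γ ≡ x ++ t × ¬ Earlier w (h ++ x)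

  -- What decides is whether a copy of w or reverse w precedes the `x` that starts the first
  -- occurrence of the hull; if so, the return ending with this `x` is the parent's hull.
  parent-or-root : ∀ γ → (∃[ π ] Parent γ π) ⊎ Root γ
  parent-or-root γ with first γ | MirrorReturn.initial (hull-return γ)
  ... | _ , ending@(pp , (h , refl) , _) | x , t , mx , eq with Earlier? _≟_ w (h ++ x)
  ... | no ¬earlier = inj₂ (x , h , t , mx , subst (FirstEnding (hull γ)) (cong (h ++_) eq) ending , eq , ¬earlier)
  ... | yes earlier with last-return _≟_ (h ++ x) h earlier mx refl
  ... | c , r , s , eq′ , ret , refl , s≢[] , refl
    with return-hull (Prefix⇒Language {c} (subst Prefix eq′
           (Prefix-init {w = t} (trans (cong ((c ++ s) ++_) eq) (sym (++-assoc (c ++ s) x t))) pp))) ret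
  ... | π , eqᵖ = inj₁ (π , x , _ , c , s ++ x ++ t , mx , ending ,
    trans (cong ((c ++ s) ++_) eq) (++-assoc c s (x ++ t)) , s , t , sym eqᵖ , eq , refl)

  -- The parent's hull ends with `x`, a proper prefix of hull `γ`, so it is completed first. This
  -- makes climbing to parents terminate and excludes mutual parents.
  Parent-< : ∀ {γ π p q} → Parent γ π → FirstEnding (hull γ) p → FirstEnding (hull π) q → length q < length p
  Parent-< {γ} {π} {q = q} (x , p , c , _ , mx , ending , eq , s , t , eqᵖ , eqᵞ , refl) endingᵞ endingᵖ
    with FirstEnding-unique endingᵞ ending
  ... | refl = ≤-trans (s≤s (FirstEnding-≤ {h = c} endingᵖ (Prefix-init {w = t} p≡ (proj₁ ending))))
      (≤-trans (length-prefix-< (c ++ hull π) (hull-tail-≢[] {γ} mx eqᵞ)) (≤-reflexive (cong length (sym p≡))))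
    where
    open ≡-Reasoning
    p≡ : p ≡ (c ++ hull π) ++ t
    p≡ = begin
      p                        ≡⟨ eq ⟩
      c ++ s ++ x ++ t         ≡⟨ cong (c ++_) (++-assoc s x t) ⟨
      c ++ (s ++ x) ++ t       ≡⟨ cong (λ f → c ++ f ++ t) eqᵖ ⟨
      c ++ hull π ++ t         ≡⟨ ++-assoc c (hull π) t ⟨
      (c ++ hull π) ++ t       ∎

  Parent-asymmetric : ∀ {γ π} → Parent γ π → ¬ Parent π γ
  Parent-asymmetric {γ} {π} par par′ with first γ | first π
  ... | _ , endingᵞ | _ , endingᵖ = <-asym (Parent-< par endingᵞ endingᵖ) (Parent-< par′ endingᵖ endingᵞ)

  root-exists : ∃[ γ ] Root γ
  root-exists = climb _ nothing (proj₂ (first nothing)) ≤-refl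
    where
    climb : ∀ n γ {p} → FirstEnding (hull γ) p → length p ≤ n → ∃[ γ ] Root γ
    climb n γ ending le with parent-or-root γ
    ... | inj₂ root = γ , root
    climb zero γ ending le | inj₁ (π , par) with ≤-trans (Parent-< par ending (proj₂ (first π))) le
    ... | ()
    climb (suc n) γ ending le | inj₁ (π , par) =
      climb n π (proj₂ (first π)) (≤-pred (≤-trans (Parent-< par ending (proj₂ (first π))) le))

  private
    extend : ∀ γ γ′ h x {t t′ d} → hull γ ≡ x ++ t → hull γ′ ≡ x ++ t′ →
      h ++ x ++ t′ ≡ (h ++ x ++ t) ++ d → hull γ′ ≡ hull γ ++ d
    extend γ γ′ h x {t} {t′} {d} eq eq′ eqᵈ = trans eq′
      (trans (++-cancelˡ h _ _ (trans eqᵈ (++-assoc h (x ++ t) d))) (cong (_++ d) (sym eq)))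

  -- Hulls form a prefix code: the final copy in the shorter hull is not at the start of the longer
  -- one, so it must be at its end.
  hull-prefix : ∀ {γ γ′ d} → hull γ′ ≡ hull γ ++ d → γ ≡ γ′
  hull-prefix {γ} {γ′} {d} eq with MirrorReturn.final (hull-return γ)
  ... | c , y , c≢[] , my , eqʸ
    with MirrorReturn.inner (hull-return γ′) c y d my (trans eq (trans (cong (_++ d) eqʸ) (++-assoc c y d)))
  ... | inj₁ c≡[] = ⊥-elim (c≢[] c≡[])
  ... | inj₂ refl = hull-injective (sym (trans eq (++-identityʳ _)))

  hull-suffix : ∀ {γ γ′ d} → hull γ′ ≡ d ++ hull γ → γ ≡ γ′
  hull-suffix {γ} {γ′} {d} eq = hull-prefix {d = reverse d}
    (trans (palindrome-++ d (hull-Palindrome γ′) eq) (cong (_++ reverse d) (hull-Palindrome γ)))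

  -- Both hulls start at the first copy of w or reverse w in u, so one is a prefix of the other.
  Root-unique : ∀ {γ γ′} → Root γ → Root γ′ → γ ≡ γ′
  Root-unique {γ} {γ′} (x , h , t , mx , (pp , _) , eq , ¬earlier)
              (x′ , h′ , t′ , mx′ , (pp′ , _) , eq′ , ¬earlier′)
    with h≡h′
    where
    pre : Prefix (h ++ x)
    pre = Prefix-init (sym (++-assoc h x t)) pp
    pre′ : Prefix (h′ ++ x′)
    pre′ = Prefix-init (sym (++-assoc h′ x′ t′)) pp′
    h≡h′ : h ++ x ≡ h′ ++ x′
    h≡h′ with Prefix-compare pre pre′
    ... | inj₁ (d , eq) with []? d
    ... | yes refl = sym (trans eq (++-identityʳ _))
    ... | no d≢[] = ⊥-elim (¬earlier′ (h , x , d , mx , d≢[] , trans eq (++-assoc h x d)))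
    h≡h′ | inj₂ (d , eq) with []? d
    ... | yes refl = trans eq (++-identityʳ _)
    ... | no d≢[] = ⊥-elim (¬earlier (h′ , x′ , d , mx′ , d≢[] , trans eq (++-assoc h′ x′ d)))
  ... | eqʰ with split-≡ʳ h h′ eqʰ (Mirror-length₂ mx mx′)
  ... | refl , refl with Prefix-compare pp pp′
  ... | inj₁ (d , eqᵈ) = hull-prefix (extend γ γ′ h x eq eq′ eqᵈ)
  ... | inj₂ (d , eqᵈ) = sym (hull-prefix (extend γ′ γ h x eq′ eq eqᵈ))

  Parent-not-Root : ∀ {γ π} → Parent γ π → ¬ Root γ
  Parent-not-Root {γ} {π} (x , p , c , _ , mx , ending , eq , s , t , eqᵖ , eqᵞ , refl)
                  (x′ , h , t′ , mx′ , ending′ , eqᵞ′ , ¬earlier)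
    with FirstEnding-unique ending ending′
  ... | refl with split-≡ˡ x x′ (trans (sym eqᵞ) eqᵞ′) (Mirror-length₂ mx mx′)
  ... | refl , refl with MirrorReturn.initial (hull-return π)
  ... | y , d , my , eqʸ = ¬earlier (c , y , d , my , hull-tail-≢[] {π} my eqʸ , (begin
      h ++ x           ≡⟨ cong (_++ x) (++-cancelʳ (x ++ t) h (c ++ s) (trans eq (sym (++-assoc c s (x ++ t))))) ⟩
      (c ++ s) ++ x    ≡⟨ ++-assoc c s x ⟩
      c ++ s ++ x      ≡⟨ cong (c ++_) eqᵖ ⟨
      c ++ hull π      ≡⟨ cong (c ++_) eqʸ ⟩
      c ++ y ++ d      ∎))
    where open ≡-Reasoning

  -- Both candidate hulls end at the same place, with the `x` that starts the first occurrence of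
  -- hull `γ`; so one is a suffix of the other.
  Parent-functional : ∀ {γ π π′} → Parent γ π → Parent γ π′ → π ≡ π′
  Parent-functional {π = π} {π′} (x , _ , c , _ , mx , ending , eq , s , t , eqᵖ , eqᵞ , refl)
                    (x′ , _ , c′ , _ , mx′ , ending′ , eq′ , s′ , t′ , eqᵖ′ , eqᵞ′ , refl)
    with FirstEnding-unique ending ending′ | split-≡ˡ x x′ (trans (sym eqᵞ) eqᵞ′) (Mirror-length₂ mx mx′)
  ... | refl | refl , refl
    with split-compare c c′ (++-cancelʳ (x ++ t) (c ++ s) (c′ ++ s′)
           (trans (++-assoc c s _) (trans (sym eq) (trans eq′ (sym (++-assoc c′ s′ _))))))
  ... | inj₁ (e , _ , refl) = sym (hull-suffix {π′} {π} {e}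
    (trans eqᵖ (trans (++-assoc e s′ x) (cong (e ++_) (sym eqᵖ′)))))
  ... | inj₂ (e , _ , refl) = hull-suffix {π} {π′} {e} (trans eqᵖ′ (trans (++-assoc e s x) (cong (e ++_) (sym eqᵖ))))

  -- `b` is the shift between two occurrences of hull `γ`. If the left one began within the
  -- preceding hull `π`, its initial `x` would be a further copy in the junction.
  no-overlap : ∀ {π γ x s t b d} → Mirror w x → hull π ≡ s ++ x → hull γ ≡ x ++ t → b ≢ [] →
    b ++ hull γ ≡ hull γ ++ d → ∀ e → s ≢ e ++ b
  no-overlap {π} {γ} {x} {s} {t} {b} {d} mx eqᵖ eqᵞ b≢[] eq e refl
    with Junction-inner {γ = π} {γ} {t = t} e mx mx eqᵖ eqᵞ (begin
      (e ++ b) ++ x ++ t     ≡⟨ ++-assoc e b (x ++ t) ⟩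
      e ++ b ++ x ++ t       ≡⟨ cong (e ++_) eq′ ⟩
      e ++ x ++ t ++ d       ∎)
    where
    open ≡-Reasoning
    eq′ : b ++ x ++ t ≡ x ++ t ++ d
    eq′ = begin
      b ++ x ++ t      ≡⟨ cong (b ++_) eqᵞ ⟨
      b ++ hull γ      ≡⟨ eq ⟩
      hull γ ++ d      ≡⟨ cong (_++ d) eqᵞ ⟩
      (x ++ t) ++ d    ≡⟨ ++-assoc x t d ⟩
      x ++ t ++ d      ∎
  ... | inj₂ (inj₁ t++d≡[]) = ++-≢[]ˡ (hull-tail-≢[] {γ} mx eqᵞ) t++d≡[]
  ... | inj₂ (inj₂ (e≡s , _)) = b≢[] (++-selfʳ e e≡s)
  -- The extra copy is at the start of hull `π`, which would then both start and end with `x`.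
  ... | inj₁ refl with split-≤ˡ x (b ++ x) (begin
      x ++ t ++ d      ≡⟨ ++-assoc x t d ⟨
      (x ++ t) ++ d    ≡⟨ cong (_++ d) eqᵞ ⟨
      hull γ ++ d      ≡⟨ eq ⟨
      b ++ hull γ      ≡⟨ cong (b ++_) eqᵞ ⟩
      b ++ x ++ t      ≡⟨ ++-assoc b x t ⟨
      (b ++ x) ++ t    ∎) (length-++-≤ʳ x {b})
    where open ≡-Reasoning
  ... | g , b++x≡x++g , _ = hull-ends-differ {π} mx eqᵖ (trans eqᵖ b++x≡x++g)

  -- If the hull of γ was seen before, the complete return to it is a palindrome extending g
  -- to the left, so g has been traversed earlier in the opposite direction.
  Junction⇒Parent : ∀ {x γ π g p c} → Mirror w x → Prefix p → p ≡ c ++ g → Junction x π γ g →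
    Parent γ π ⊎ Parent π γ
  Junction⇒Parent {p = p} mx pp eq junction = descend (length p) mx pp ≤-refl eq junction
    where
    descend : ∀ n {x γ π g p c} → Mirror w x → Prefix p → length p ≤ n → p ≡ c ++ g → Junction x π γ g →
      Parent γ π ⊎ Parent π γ
    descend n {x} {γ} {π} {_} {p} {c} mx pp le eq junction@(s , t , eqᵖ , eqᵞ , refl) with Earlier? _≟_ (hull γ) p
    ... | no ¬earlier = inj₁ (x , p , c , _ , mx ,
      not-earlier⇒FirstEnding {h = c ++ s} pp
        (trans eq (trans (sym (++-assoc c s _)) (cong ((c ++ s) ++_) (sym eqᵞ)))) ¬earlier ,
      eq , junction)
    ... | yes earlier with last-return _≟_ p (c ++ s) earlier (inj₁ refl)
                             (trans eq (trans (sym (++-assoc c s _)) (cong ((c ++ s) ++_) (sym eqᵞ))))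
    ... | c′ , r , b , eq′ , ret , eqʳ , b≢[] , eqᵇ
      with return-Palindrome (Prefix⇒Language {c′} (subst Prefix eq′ pp)) ret | MirrorReturn.initial ret
    ... | palr | y , d , my , eqʸ with Mirror-palindrome (hull-Palindrome γ) my
    ... | refl with split-compare c c′ eqᵇ
    -- The previous occurrence of hull `γ` starts neither inside hull `π` nor exactly where it
    -- starts; in the remaining case `r` reaches back beyond the junction.
    ... | inj₁ (e , _ , eqˢ) = ⊥-elim (no-overlap {π} {γ} mx eqᵖ eqᵞ b≢[] (trans (sym eqʳ) eqʸ) e eqˢ)
    ... | inj₂ ([] , _ , eqᵇ′) = ⊥-elim (no-overlap {π} {γ} mx eqᵖ eqᵞ b≢[] (trans (sym eqʳ) eqʸ) [] (sym eqᵇ′))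
    ... | inj₂ (q ∷ e , refl , refl) = shorter n le
      where
      open ≡-Reasoning
      g = s ++ x ++ t
      r≡ : r ≡ (q ∷ e) ++ g
      r≡ = begin
        r                            ≡⟨ eqʳ ⟩
        ((q ∷ e) ++ s) ++ hull γ     ≡⟨ ++-assoc (q ∷ e) s (hull γ) ⟩
        (q ∷ e) ++ s ++ hull γ       ≡⟨ cong (λ f → (q ∷ e) ++ s ++ f) eqᵞ ⟩
        (q ∷ e) ++ g                 ∎
      p≡ : p ≡ (c′ ++ reverse g) ++ reverse (q ∷ e)
      p≡ = begin
        p                                      ≡⟨ eq′ ⟩
        c′ ++ r                                ≡⟨ cong (c′ ++_) (palindrome-++ (q ∷ e) palr r≡) ⟩
        c′ ++ reverse g ++ reverse (q ∷ e)     ≡⟨ ++-assoc c′ (reverse g) _ ⟨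
        (c′ ++ reverse g) ++ reverse (q ∷ e)   ∎
      p< : length (c′ ++ reverse g) < length p
      p< = ≤-trans (length-prefix-< (c′ ++ reverse g) (reverse-≢[] {xs = q ∷ e} (λ ())))
        (≤-reflexive (cong length (sym p≡)))
      shorter : ∀ n → length p ≤ n → Parent γ π ⊎ Parent π γ
      shorter zero le with ≤-trans p< le
      ... | ()
      -- The earlier traversal runs from `γ` to `π`, so the answer comes with the roles exchanged.
      shorter (suc n) le = swap (descend n {c = c′} (Mirror-reverse mx)
        (Prefix-init {w = reverse (q ∷ e)} p≡ pp) (≤-pred (≤-trans p< le)) refl
        (Junction-reverse {γ = π} {γ} junction))

  -- The walk may cross the parent edge through reverse w, which gives a return word directly, or
  -- through w; then the reversed junction, also in the language, crosses through reverse w.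
  Parent⇒Passage : ∀ {γ π} → Parent γ π → ∃[ v ] (Passage v π γ ⊎ Passage v γ π)
  Parent⇒Passage {γ} {π} (_ , _ , c , _ , inj₂ refl , ending , eq , junction) =
    map₂ inj₁ (Junction⇒Passage {π} {γ} junction (Prefix⇒Language {c} (subst Prefix eq (proj₁ ending))))
  Parent⇒Passage {γ} {π} (_ , _ , c , _ , inj₁ refl , ending , eq , junction) =
    map₂ inj₂ (Junction⇒Passage {γ} {π} (Junction-reverse {γ = π} {γ} junction)
      (reverse-Language (Prefix⇒Language {c} (subst Prefix eq (proj₁ ending)))))

  -- Each centre other than the root indexes the edge to its parent. `R` admits both directions
  -- because a return word shows its edge only through reverse w, which may lead to the parent or
  -- away from it.
  count : HasExactly k (CompleteReturn w)
  count with root-exists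
  ... | ρ , root = HasExactly-bijection R total onto functional injective (HasExactly-Maybe-≢ _≟_ alphabet ρ)
    where
    R : Maybe A → List A → Set a
    R γ v = ∃[ π ] Parent γ π × (Passage v π γ ⊎ Passage v γ π)

    total : ∀ {γ} → γ ≢ ρ → ∃[ v ] R γ v × CompleteReturn w v
    total {γ} γ≢ρ with parent-or-root γ
    ... | inj₂ root′ = ⊥-elim (γ≢ρ (Root-unique root′ root))
    ... | inj₁ (π , par) with Parent⇒Passage par
    ... | v , inj₁ passage = v , (π , par , inj₁ passage) , Passage⇒CompleteReturn passage
    ... | v , inj₂ passage = v , (π , par , inj₂ passage) , Passage⇒CompleteReturn passage

    onto : ∀ {v} → CompleteReturn w v → ∃[ γ ] γ ≢ ρ × R γ v
    onto ret with CompleteReturn⇒Passage ret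
    ... | γ , π , passage@(junction , Lv) with Language⇒Prefix Lv
    ... | h , pp with Junction⇒Parent {c = h} (inj₂ refl) pp refl junction
    ... | inj₁ par = π , (λ { refl → Parent-not-Root par root }) , γ , par , inj₁ passage
    ... | inj₂ par = γ , (λ { refl → Parent-not-Root par root }) , π , par , inj₂ passage

    functional : ∀ {γ v v′} → R γ v → R γ v′ → v ≡ v′
    functional {γ} (π , par , p) (π′ , par′ , p′) with Parent-functional par par′
    functional (π , par , inj₁ p) (_ , _ , inj₁ p′) | refl = Passage-functional p p′
    functional (π , par , inj₂ p) (_ , _ , inj₂ p′) | refl = Passage-functional p p′
    functional (π , par , inj₁ p) (_ , _ , inj₂ p′) | refl = ⊥-elim (Passage-asymmetric p p′)
    functional (π , par , inj₂ p) (_ , _ , inj₁ p′) | refl = ⊥-elim (Passage-asymmetric p p′)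

    injective : ∀ {γ γ′ v} → R γ v → R γ′ v → γ ≡ γ′
    injective (_ , par , inj₁ p) (_ , par′ , inj₁ p′) = proj₂ (Passage-injective p p′)
    injective (_ , par , inj₂ p) (_ , par′ , inj₂ p′) = proj₁ (Passage-injective p p′)
    -- The two centres are the ends of one edge, and each would be the parent of the other.
    injective (_ , par , inj₁ p) (_ , par′ , inj₂ p′) with Passage-injective p p′
    ... | refl , refl = ⊥-elim (Parent-asymmetric par par′)
    injective (_ , par , inj₂ p) (_ , par′ , inj₁ p′) with Passage-injective p p′
    ... | refl , refl = ⊥-elim (Parent-asymmetric par par′)

corollary25 : ∀ {a} {A : Set a} (k : ℕ) → A ↔ Fin k →
    (u : InfiniteWord A) → EveryLetterOccurs u →
    UniformlyRecurrent u →
    UniquePalindromicExtensions u →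
    Rich u ⇔ (∀ w → Language u w → HasExactly k (ReturnWord u w))
corollary25 {A = A} k A↔Fin u letters ur upe = mk⇔ to from
  where
  _≟_ : DecidableEquality A
  _≟_ = via-injection (↔⇒↣ A↔Fin) Fin._≟_

  open Occurrence u
  open Richness _≟_ u
  open Centres _≟_ u letters ur upe

  alphabet : HasExactly k (λ (_ : A) → ⊤)
  alphabet = HasExactly-Fin A↔Fin

  to : Rich u → ∀ w → Language u w → HasExactly k (ReturnWord u w)
  to rich w L = HasExactly-cong (λ v → ⇔-sym (ReturnWord⇔CompleteReturn w v)) returns
    where
    returns : HasExactly k (CompleteReturn w)
    returns with ≡-dec _≟_ (reverse w) w
    ... | yes pal = PalindromicReturns.Rich⇒count L pal alphabet rich
    ... | no nonpal = NonPalindromicReturns.count _≟_ u letters ur upe rich L nonpal alphabet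

  from : (∀ w → Language u w → HasExactly k (ReturnWord u w)) → Rich u
  from exactly-k = MirrorReturn-palindrome⇒Rich λ {w} L pal →
    PalindromicReturns.MirrorReturn-palindrome L pal alphabet
      (HasExactly-cong (ReturnWord⇔CompleteReturn w) (exactly-k w L))
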